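{- Let $\kappa\leq\lambda$ be infinite cardinals with $\kappa$ regular, and assume $\lambda^{<\kappa}=\lambda<\lambda^{\kappa}$. Then there exist a positively totally ordered monoid $\mathbb{S}$, a partial function $\mathsf{Sum}:{}^{<\mathrm{On}}\mathbb{S}\to\mathbb{S}$ satisfying (S1) but not (S2), and a non-$\lambda$-Dirac, continuous weak $\lambda^+$-measure space $({}^{\kappa}\lambda,\mathfrak{M},\mu)$ on ${}^{\kappa}\lambda$ with $\mu$ taking values in $(\mathbb{S},\mathsf{Sum})$.
   Context: **Topology.** ${}^{\kappa}\lambda$ is the set of sequences of elements of $\lambda$ of length $\kappa$, with the bounded topology, generated by the cones $\mathbf{N}_s=\{x\in{}^{\kappa}\lambda\mid s\subseteq x\}$ for $s\in{}^{<\kappa}\lambda=\bigcup_{\alpha<\kappa}{}^{\alpha}\lambda$. **Monoids and sums.** A positively totally ordered monoid is $\mathbb{S}=(S,0,+,\leq)$ where $+$ is associative (not necessarily commutative) with neutral element $0$, $\leq$ is a total order, $a\leq b$ and $c\leq d$ imply $a+c\leq b+d$, $0$ is the minimum of $\leq$, and $S\neq\{0\}$. ${}^{<\mathrm{On}}\mathbb{S}$ is the class of all sequences of elements of $S$ of ordinal length; $\mathrm{lh}(s)$ is the length of $s$. For a partial function $\mathsf{Sum}:{}^{<\mathrm{On}}\mathbb{S}\to\mathbb{S}$ consider the axioms: (S1) $\mathsf{Sum}(\emptyset)=0$ and $\mathsf{Sum}(s)=s_0+\dots+s_n$ for every non-empty finite $s=(s_i)_{i\leq n}\in\mathrm{dom}(\mathsf{Sum})$;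 (S2) (continuity) for all $s\in\mathrm{dom}(\mathsf{Sum})$ of limit length, if $s\restriction\alpha\in\mathrm{dom}(\mathsf{Sum})$ for cofinally many $\alpha<\mathrm{lh}(s)$, then $\mathsf{Sum}(s)=\sup\{\mathsf{Sum}(s\restriction\alpha)\mid\alpha<\mathrm{lh}(s),\ s\restriction\alpha\in\mathrm{dom}(\mathsf{Sum})\}$. **Measures.** (In this statement $\mathsf{Sum}$ is not required to satisfy (S2).) A weakly $\lambda^+$-measurable space is a pair $(X,\mathfrak{M})$ where $X$ is a topological space and $\mathfrak{M}$ is a family of subsets of $X$ closed under unions of size $\leq\lambda$ and containing all open subsets of $X$. A $\lambda^+$-measure on it with values in $(\mathbb{S},\mathsf{Sum})$ is a partial function $\mu:\mathscr{P}(X)\to\mathbb{S}$ with $\mathfrak{M}\subseteq\mathrm{dom}(\mu)$ such that: (M1) $\mu(\emptyset)=0$; (M2) $\mu(X)>0$; (M3) $A\subseteq B$ implies $\mu(A)\leq\mu(B)$ for all $A,B\in\mathfrak{M}$; (M4) for every family $(A_i)_{i<\gamma}$ of pairwise disjoint sets of $\mathfrak{M}$ of length an ordinal $\gamma<\lambda^+$, we have $\langle\mu(A_i)\mid i<\gamma\rangle\in\mathrm{dom}(\mathsf{Sum})$ and $\mu(\bigcup_{i<\gamma}A_i)=\mathsf{Sum}(\langle\mu(A_i)\mid i<\gamma\rangle)$; (M5) for every $x\in X$ with $\{x\}\in\mathfrak{M}$ and every open local basis $\{A_i\mid i<\gamma\}$ at $x$ with $\gamma<\lambda^+$, $\mu(\{x\})=\inf_{i<\gamma}\mu(A_i)$.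 Then $(X,\mathfrak{M},\mu)$ is called a weak $\lambda^+$-measure space. It is continuous if $\{x\}\in\mathfrak{M}$ and $\mu(\{x\})=0$ for every $x\in X$. The support of $\mu$ is $\mathrm{supp}(\mu)=X\setminus\bigcup\{O\mid O\text{ open},\ \mu(O)=0\}$. For a cardinal $\gamma$, $\mu$ is $\gamma$-Dirac if $\mathrm{supp}(\mu)$ has weight strictly less than $\gamma$. -}

module Defs where

open import Level using (0ℓ; suc)
open import Algebra.Bundles using (RawMonoid)
open import Algebra.Definitions.RawMonoid using (sum)
open import Algebra.Structures using (IsMonoid)
open import Data.Fin.Base as Fin using (Fin)
import Data.Fin.Induction as Fin
import Data.Fin.Properties as Fin
open import Data.Maybe using (Maybe; just; Is-just)
open import Data.Nat.Base as ℕ using (ℕ)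
open import Data.Product using (Σ; Σ-syntax; ∃; ∃-syntax; _×_; _,_; proj₁; proj₂)
open import Function.Base using (_on_)
open import Function.Bundles using (_↣_; _⤖_; _↔_; Inverse)
open import Induction.WellFounded using (WellFounded)
open import Relation.Binary.Core using (Rel; _Preserves_⟶_; _Preserves₂_⟶_⟶_)
open import Relation.Binary.Definitions using (Trichotomous; Tri; tri<; tri≈; tri>; Irrelevant)
open import Relation.Binary.Structures using (IsStrictTotalOrder; IsTotalOrder)
import Relation.Binary.Construct.On as On
open import Relation.Binary.PropositionalEquality using (_≡_; _≢_; refl; cong; isEquivalence)
open import Relation.Nullary using (¬_)
open import Relation.Unary using (Pred; _∈_; _⊆_; _≐_; _∩_; _⊥_; ∁; U; ∅; ｛_｝; ⋃)

-- Conventions.  The ambient classical set theory is rendered by excluded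
-- middle for all types (which also yields choice) and function
-- extensionality; they are hypotheses of the theorem, and no definition below
-- depends on them.  Subsets are `Pred X 0ℓ`, compared by `_≐_`; under excluded
-- middle each one is `_≐_` to a Bool-valued one, so that these form the full
-- power set.  Partial functions are total functions into `Maybe`.

------------------------------------------------------------------------
-- Ordinals

-- A well-ordered type; ordinals are identified along order isomorphisms.
-- `<-irrelevant` makes `Segment` a genuine subset of the carrier.
record Ordinal : Set₁ where
  infix 4 _<_
  field
    Carrier            : Set
    _<_                : Rel Carrier 0ℓ
    isStrictTotalOrder : IsStrictTotalOrder _≡_ _<_
    <-irrelevant       : Irrelevant _<_
    wellFounded        : WellFounded _<_

  open IsStrictTotalOrder isStrictTotalOrder public using (compare)

∣_∣ : Ordinal → Set
∣_∣ = Ordinal.Carrier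

-- The elements of an ordinal play the role of the smaller ordinals: a stands
-- for the ordinal (segment γ a).
Segment : (γ : Ordinal) → ∣ γ ∣ → Set
Segment γ a = Σ[ i ∈ ∣ γ ∣ ] Ordinal._<_ γ i a

segment : (γ : Ordinal) → ∣ γ ∣ → Ordinal
segment γ a = record
  { Carrier            = Segment γ a
  ; _<_                = γ._<_ on proj₁
  ; isStrictTotalOrder = record
    { isStrictPartialOrder = record
      { isEquivalence = isEquivalence
      ; irrefl        = λ { refl → STO.irrefl refl }
      ; trans         = STO.trans
      ; <-resp-≈      = (λ { refl p → p }) , (λ { refl p → p })
      }
    ; compare = cmp
    }
  ; <-irrelevant       = γ.<-irrelevant
  ; wellFounded        = On.wellFounded proj₁ γ.wellFounded
  }
  where
  module γ = Ordinal γ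
  module STO = IsStrictTotalOrder γ.isStrictTotalOrder

  ext : {x y : Segment γ a} → proj₁ x ≡ proj₁ y → x ≡ y
  ext {i , p} {.i , q} refl = cong (i ,_) (γ.<-irrelevant p q)

  cmp : Trichotomous _≡_ (γ._<_ on proj₁)
  cmp x y with γ.compare (proj₁ x) (proj₁ y)
  ... | tri< l n g = tri< l (λ e → n (cong proj₁ e)) g
  ... | tri≈ l e g = tri≈ l (ext e) g
  ... | tri> l n g = tri> l (λ e → n (cong proj₁ e)) g

finite : ℕ → Ordinal
finite n = record
  { Carrier            = Fin n
  ; _<_                = Fin._<_
  ; isStrictTotalOrder = Fin.<-isStrictTotalOrder
  ; <-irrelevant       = Fin.<-irrelevant
  ; wellFounded        = Fin.<-wellFounded
  }

IsLimit : Ordinal → Set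
IsLimit γ = ∣ γ ∣ × (∀ a → ∃[ b ] a < b)
  where open Ordinal γ

------------------------------------------------------------------------
-- Cardinals

infix 4 _≼_ _≺_

_≼_ : Set → Set → Set
A ≼ B = A ↣ B

_≺_ : Set → Set → Set
A ≺ B = A ≼ B × ¬ (B ≼ A)

-- Initial ordinals.
IsCardinal : Ordinal → Set
IsCardinal γ = ∀ a → ¬ (∣ γ ∣ ⤖ Segment γ a)

IsInfiniteCardinal : Ordinal → Set
IsInfiniteCardinal γ = IsCardinal γ × ℕ ≼ ∣ γ ∣

Cofinal : {I : Set} (γ : Ordinal) → (I → ∣ γ ∣) → Set
Cofinal γ f = ∀ b → ∃[ i ] ¬ (f i < b)
  where open Ordinal γ

IsRegular : Ordinal → Set
IsRegular γ = ∀ a (f : Segment γ a → ∣ γ ∣) → ¬ Cofinal γ f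

-- Sequences of elements of A of length <κ, and of length κ.
Seq< : Ordinal → Set → Set
Seq< κ A = Σ[ a ∈ ∣ κ ∣ ] (Segment κ a → A)

Seqκ : Ordinal → Set → Set
Seqκ κ A = ∣ κ ∣ → A

-- γ < card⁺ for an ordinal γ: the successor cardinal of card consists of the
-- ordinals of cardinality at most card.
_<_⁺ : Ordinal → Ordinal → Set
γ < card ⁺ = ∣ γ ∣ ≼ ∣ card ∣

------------------------------------------------------------------------
-- Topological spaces

record Space : Set₂ where
  field
    Point     : Set
    Open      : Pred (Pred Point 0ℓ) (suc 0ℓ)
    open-resp : ∀ {A B} → A ≐ B → Open A → Open B
    open-U    : Open U
    open-∩    : ∀ {A B} → Open A → Open B → Open (A ∩ B)
    open-⋃    : ∀ {I : Set} {A : I → Pred Point 0ℓ} → (∀ i → Open (A i)) → Open (⋃ I A)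

data Generated {X I : Set} (B : I → Pred X 0ℓ) : Pred (Pred X 0ℓ) (suc 0ℓ) where
  generator : ∀ i → Generated B (B i)
  resp      : ∀ {P Q} → P ≐ Q → Generated B P → Generated B Q
  whole     : Generated B U
  inter     : ∀ {P Q} → Generated B P → Generated B Q → Generated B (P ∩ Q)
  union     : ∀ {J : Set} {A : J → Pred X 0ℓ} → (∀ j → Generated B (A j)) → Generated B (⋃ J A)

generatedSpace : {X I : Set} → (I → Pred X 0ℓ) → Space
generatedSpace {X} B = record
  { Point     = X
  ; Open      = Generated B
  ; open-resp = resp
  ; open-U    = whole
  ; open-∩    = inter
  ; open-⋃    = union
  }

cone : (κ : Ordinal) {A : Set} → Seq< κ A → Pred (Seqκ κ A) 0ℓ
cone κ (a , s) x = ∀ (i : Segment κ a) → x (proj₁ i) ≡ s i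

boundedSpace : Ordinal → Ordinal → Space
boundedSpace κ lam = generatedSpace (cone κ {∣ lam ∣})

IsLocalBasis : (X : Space) → Space.Point X → {I : Set} → (I → Pred (Space.Point X) 0ℓ) → Set₁
IsLocalBasis X x A =
  (∀ i → Open (A i) × x ∈ A i) ×
  (∀ O → Open O → x ∈ O → ∃[ i ] A i ⊆ O)
  where open Space X

-- The subspace C has weight < card: the traces on C of fewer than card open
-- sets of X form a base of C.
Weight< : (X : Space) → Pred (Space.Point X) (suc 0ℓ) → Ordinal → Set₁
Weight< X C card =
  Σ[ I ∈ Set ] I ≺ ∣ card ∣ ×
  Σ[ B ∈ (I → Pred Point 0ℓ) ]
    (∀ i → Open (B i)) ×
    (∀ O x → Open O → x ∈ C → x ∈ O → ∃[ i ] (x ∈ B i × B i ∩ C ⊆ O))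
  where open Space X

------------------------------------------------------------------------
-- Positively totally ordered monoids and transfinite sums

record PTOMonoid : Set₁ where
  infix  4 _≤_
  infixl 6 _+_
  field
    Carrier      : Set
    0#           : Carrier
    _+_          : Carrier → Carrier → Carrier
    _≤_          : Rel Carrier 0ℓ
    isMonoid     : IsMonoid _≡_ _+_ 0#
    isTotalOrder : IsTotalOrder _≡_ _≤_
    +-mono-≤     : _+_ Preserves₂ _≤_ ⟶ _≤_ ⟶ _≤_
    0-minimum    : ∀ a → 0# ≤ a
    nontrivial   : ∃[ a ] a ≢ 0#

  rawMonoid : RawMonoid 0ℓ 0ℓ
  rawMonoid = record { Carrier = Carrier ; _≈_ = _≡_ ; _∙_ = _+_ ; ε = 0# }

  IsSup : ∀ {ℓ} → Pred Carrier ℓ → Carrier → Set ℓ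
  IsSup P v = (∀ {w} → w ∈ P → w ≤ v) × (∀ u → (∀ {w} → w ∈ P → w ≤ u) → v ≤ u)

  IsInf : ∀ {ℓ} → Pred Carrier ℓ → Carrier → Set ℓ
  IsInf P v = (∀ {w} → w ∈ P → v ≤ w) × (∀ u → (∀ {w} → w ∈ P → u ≤ w) → u ≤ v)

record OrdSeq (A : Set) : Set₁ where
  constructor ⟨_,_⟩
  field
    lh : Ordinal
    at : ∣ lh ∣ → A

open OrdSeq

infixl 7 _↾_
_↾_ : {A : Set} (s : OrdSeq A) → ∣ lh s ∣ → OrdSeq A
s ↾ a = ⟨ segment (lh s) a , (λ i → at s (proj₁ i)) ⟩

-- Equality of sequences, their lengths being ordinals up to isomorphism.
record _≅_ {A : Set} (s t : OrdSeq A) : Set where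
  field
    iso  : ∣ lh s ∣ ↔ ∣ lh t ∣
    mono : Inverse.to iso Preserves Ordinal._<_ (lh s) ⟶ Ordinal._<_ (lh t)
    same : ∀ i → at t (Inverse.to iso i) ≡ at s i

record PartialSum (S : PTOMonoid) : Set₁ where
  open PTOMonoid S
  field
    Sum      : OrdSeq Carrier → Maybe Carrier
    Sum-cong : ∀ {s t} → s ≅ t → Sum s ≡ Sum t

  S1 : Set
  S1 =
    (∀ (s : Fin 0 → Carrier) → Sum ⟨ finite 0 , s ⟩ ≡ just 0#) ×
    (∀ n (s : Fin (ℕ.suc n) → Carrier) v →
      Sum ⟨ finite (ℕ.suc n) , s ⟩ ≡ just v → v ≡ sum rawMonoid s)

  S2 : Set₁
  S2 = ∀ s v → IsLimit (lh s) → Sum s ≡ just v →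
    (∀ a → ∃[ b ] (Ordinal._<_ (lh s) a b × Is-just (Sum (s ↾ b)))) →
    IsSup (λ w → ∃[ a ] Sum (s ↾ a) ≡ just w) v

------------------------------------------------------------------------
-- Measures

record WeakMeasureSpace (card : Ordinal) (X : Space) (S : PTOMonoid) (Σ∞ : PartialSum S) : Set₂ where
  open Space X
  open PTOMonoid S
  open PartialSum Σ∞ using (Sum)
  field
    𝔐      : Pred (Pred Point 0ℓ) (suc 0ℓ)
    𝔐-resp : ∀ {A B} → A ≐ B → 𝔐 A → 𝔐 B
    𝔐-⋃    : ∀ {I : Set} {A : I → Pred Point 0ℓ} → I ≼ ∣ card ∣ → (∀ i → 𝔐 (A i)) → 𝔐 (⋃ I A)
    𝔐-open : ∀ {A} → Open A → 𝔐 A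

    μ      : Pred Point 0ℓ → Maybe Carrier
    μ-cong : ∀ {A B} → A ≐ B → μ A ≡ μ B
    μ-dom  : ∀ {A} → 𝔐 A → Is-just (μ A)

    M1 : μ ∅ ≡ just 0#
    M2 : ∃[ v ] (μ U ≡ just v × 0# ≤ v × 0# ≢ v)
    M3 : ∀ {A B a b} → 𝔐 A → 𝔐 B → A ⊆ B → μ A ≡ just a → μ B ≡ just b → a ≤ b
    M4 : ∀ (γ : Ordinal) → γ < card ⁺ →
         (A : ∣ γ ∣ → Pred Point 0ℓ) → (∀ i → 𝔐 (A i)) → (∀ {i j} → i ≢ j → A i ⊥ A j) →
         (m : ∣ γ ∣ → Carrier) → (∀ i → μ (A i) ≡ just (m i)) →
         ∃[ v ] (Sum ⟨ γ , m ⟩ ≡ just v × μ (⋃ ∣ γ ∣ A) ≡ just v)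
    M5 : ∀ x → 𝔐 ｛ x ｝ → (γ : Ordinal) → γ < card ⁺ →
         (A : ∣ γ ∣ → Pred Point 0ℓ) → IsLocalBasis X x A →
         ∀ v → μ ｛ x ｝ ≡ just v → IsInf (λ w → ∃[ i ] μ (A i) ≡ just w) v

  Continuous : Set₁
  Continuous = ∀ x → 𝔐 ｛ x ｝ × μ ｛ x ｝ ≡ just 0#

  supp : Pred Point (suc 0ℓ)
  supp = ∁ (λ x → ∃[ O ] (Open O × μ O ≡ just 0# × x ∈ O))

  Dirac : Ordinal → Set₁
  Dirac δ = Weight< X supp δ

{-# OPTIONS --safe #-}

-- Call a set null if it has at most λ elements.  The functions X → ℤ on
-- X = κ → λ modulo null sets form a torsion-free abelian group, in which the
-- functions that are nonnegative, or positive on most of some basic open set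
-- (see Dominant), are the positive elements of a translation-invariant partial
-- order; Zorn's lemma extends it to a total order.  The value
-- of a set is the class of its indicator function.  This is finitely additive,
-- and it is injective modulo null sets, so the value of a union of ≤ λ disjoint
-- sets is a function of their values: that function is the transfinite sum.
-- Each basic open set is infinitesimal relative to those of shorter sequences,
-- which gives values tending to 0 at every point, although none of them is null.
-- The same infinitesimals lie between partial sums and sums, against (S2).
module Submission where

open import Defs
open import Level using (0ℓ; suc; Lift; lift; lower)
open import Algebra.Bundles using (AbelianGroup)
open import Algebra.Definitions.RawMonoid using (sum)
import Algebra.Properties.AbelianGroup as AbelianGroupProperties
import Algebra.Properties.CommutativeMonoid.Mult as Mult
open import Axiom.ExcludedMiddle using (ExcludedMiddle)
open import Axiom.Extensionality.Propositional using (Extensionality; lower-extensionality)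
open import Data.Bool.Base using (Bool; true; false; T; if_then_else_)
open import Data.Empty using (⊥-elim)
open import Data.Fin.Base as Fin using (Fin)
import Data.Fin.Properties as Fin
open import Data.Integer.Base as ℤ using (ℤ; +_; 0ℤ; 1ℤ)
import Data.Integer.Properties as ℤ
open import Data.Integer.Tactic.RingSolver using (solve-∀)
open import Data.List.Base using (List; []; _∷_; _++_; map)
open import Data.List.Relation.Unary.All as All using (All; []; _∷_)
import Data.List.Relation.Unary.All.Properties as All
open import Data.Maybe using (Is-just)
open import Data.Maybe.Base using (Maybe; just; nothing)
open import Data.Maybe.Properties using (just-injective)
import Data.Maybe.Relation.Unary.Any as Maybe
open import Data.Nat.Base as ℕ using (ℕ; zero)
open import Data.Nat.Properties using (*-comm)
open import Data.Product using (Σ-syntax; ∃; ∃-syntax; _×_; _,_; proj₁; proj₂)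
open import Data.Sum.Base using (_⊎_; inj₁; inj₂; [_,_]′)
open import Function.Base using (_∘_; id; const)
open import Function.Bundles using (_⤖_; _↔_; mk↣; module Injection; module Bijection; module Inverse)
open import Function.Properties.Inverse using (↔-sym)
open import Relation.Binary.Definitions using (tri<; tri≈; tri>)
open import Relation.Binary.PropositionalEquality
  using (_≡_; _≢_; refl; sym; trans; cong; cong₂; cong-app; subst; isEquivalence)
import Relation.Binary.Reasoning.Setoid as SetoidReasoning
open import Relation.Binary.Structures using (IsStrictTotalOrder)
open import Relation.Nullary using (¬_; Dec; yes; no)
open import Relation.Nullary.Decidable
  using (map′; recompute; ⌊_⌋; toWitness; fromWitness; decidable-stable)
open import Relation.Unary using (Pred; _∈_; _⊆_; _≐_; _∩_; _⊥_; ∁; U; ∅; ｛_｝; ⋃)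

-- Classical logic, choice of representatives and Zorn's lemma.

module Choice (em : ExcludedMiddle (suc 0ℓ)) (ext : Extensionality (suc 0ℓ) (suc 0ℓ)) where

  dec : (P : Set) → Dec P
  dec P = map′ lower lift (em {Lift (suc 0ℓ) P})

  funext : Extensionality 0ℓ 0ℓ
  funext = lower-extensionality (suc 0ℓ) (suc 0ℓ) ext

  stable : {P : Set} → ¬ ¬ P → P
  stable {P} = decidable-stable (dec P)

  ¬∀⇒∃¬ : {A : Set} {P : A → Set} → ¬ (∀ x → P x) → ∃[ x ] ¬ P x
  ¬∀⇒∃¬ {A} {P} ¬∀ = stable λ ¬∃ → ¬∀ λ x → stable λ ¬Px → ¬∃ (x , ¬Px)

  T-injective : ∀ {b c} → (T b → T c) → (T c → T b) → b ≡ c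
  T-injective {false} {false} _ _ = refl
  T-injective {false} {true}  _ g = ⊥-elim (g _)
  T-injective {true}  {false} f _ = ⊥-elim (f _)
  T-injective {true}  {true}  _ _ = refl

  opaque
    -- The decision is an argument, so that relations in `Set` (decided by `dec`) and in `Set₁`
    -- (decided by `em`) share one definite description.
    describe : ∀ {a b} {V : Set a} {R : V → Set b} → Dec (∃ R) → Maybe V
    describe (yes (v , _)) = just v
    describe (no _)        = nothing

    describe-holds : ∀ {a b} {V : Set a} {R : V → Set b} → (d : Dec (∃ R)) → ∀ {v} → describe d ≡ just v → R v
    describe-holds (yes (_ , Rv)) refl = Rv

    describe-just : ∀ {a b} {V : Set a} {R : V → Set b} → (∀ {v w} → R v → R w → v ≡ w) →
      (d : Dec (∃ R)) → ∀ {v} → R v → describe d ≡ just v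
    describe-just unique (yes (_ , Rw)) Rv = cong just (unique Rw Rv)
    describe-just unique (no ¬∃)        Rv = ⊥-elim (¬∃ (_ , Rv))

    describe-cong : ∀ {a b} {V : Set a} {R R′ : V → Set b} → (∀ {v w} → R v → R w → v ≡ w) →
      (d : Dec (∃ R)) (d′ : Dec (∃ R′)) → (∀ {v} → R v → R′ v) → (∀ {v} → R′ v → R v) → describe d ≡ describe d′
    describe-cong unique (yes (_ , Rv)) (yes (_ , R′w)) R⊆R′ R′⊆R = cong just (unique Rv (R′⊆R R′w))
    describe-cong unique (yes (v , Rv)) (no ¬∃)         R⊆R′ R′⊆R = ⊥-elim (¬∃ (v , R⊆R′ Rv))
    describe-cong unique (no ¬∃)        (yes (w , R′w)) R⊆R′ R′⊆R = ⊥-elim (¬∃ (w , R′⊆R R′w))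
    describe-cong unique (no _)         (no _)          R⊆R′ R′⊆R = refl

  -- Representatives of the classes of an equivalence relation: the class is
  -- coded by a Bool-valued predicate, so that equivalent elements have
  -- propositionally equal classes and the choice made for them is the same.
  module Representative {A : Set} (_~_ : A → A → Set)
    (~-refl : ∀ {x} → x ~ x) (~-sym : ∀ {x y} → x ~ y → y ~ x)
    (~-trans : ∀ {x y z} → x ~ y → y ~ z → x ~ z) where

    private
      choose : A → (A → Bool) → A
      choose d p with dec (Σ[ x ∈ A ] T (p x))
      ... | yes (x , _) = x
      ... | no _        = d

      choose-∈ : ∀ (d : A) (p : A → Bool) → Σ[ x ∈ A ] T (p x) → T (p (choose d p))
      choose-∈ d p ∃p with dec (Σ[ x ∈ A ] T (p x))
      ... | yes (_ , px) = px
      ... | no ¬∃p       = ⊥-elim (¬∃p ∃p)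

      choose-default : ∀ (d d′ : A) (p : A → Bool) → Σ[ x ∈ A ] T (p x) → choose d p ≡ choose d′ p
      choose-default d d′ p ∃p with dec (Σ[ x ∈ A ] T (p x))
      ... | yes _  = refl
      ... | no ¬∃p = ⊥-elim (¬∃p ∃p)

      class : A → A → Bool
      class x y = ⌊ dec (x ~ y) ⌋

      class-cong : ∀ {x y} → x ~ y → class x ≡ class y
      class-cong x~y = funext λ z → T-injective
        (λ t → fromWitness (~-trans (~-sym x~y) (toWitness t)))
        (λ t → fromWitness (~-trans x~y (toWitness t)))

      class-∈ : ∀ x → Σ[ y ∈ A ] T (class x y)
      class-∈ x = x , fromWitness ~-refl

    opaque
      rep : A → A
      rep x = choose x (class x)

      rep-~ : ∀ x → rep x ~ x
      rep-~ x = ~-sym (toWitness (choose-∈ x (class x) (class-∈ x)))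

      rep-cong : ∀ {x y} → x ~ y → rep x ≡ rep y
      rep-cong {x} {y} x~y = trans (choose-default x y (class x) (class-∈ x))
                                   (cong (choose y) (class-cong x~y))

  -- Zorn's lemma for families of subsets, by the Bourbaki–Witt argument.
  module Zorn {A : Set} where

    Subset : Set
    Subset = A → Bool

    infix 4 _⊑_
    _⊑_ : Subset → Subset → Set
    P ⊑ Q = ∀ {x} → T (P x) → T (Q x)

    ⊑-antisym : ∀ {P Q} → P ⊑ Q → Q ⊑ P → P ≡ Q
    ⊑-antisym P⊑Q Q⊑P = funext λ x → T-injective P⊑Q Q⊑P

    ⋃ˢ : {I : Set} → (I → Subset) → Subset
    ⋃ˢ F x = ⌊ dec (∃[ i ] T (F i x)) ⌋

    ⊑-⋃ˢ : {I : Set} (F : I → Subset) (i : I) → F i ⊑ ⋃ˢ F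
    ⊑-⋃ˢ F i t = fromWitness (i , t)

    ⋃ˢ-⊑ : {I : Set} (F : I → Subset) {Q : Subset} → (∀ i → F i ⊑ Q) → ⋃ˢ F ⊑ Q
    ⋃ˢ-⊑ F F⊑Q t = let i , Fix = toWitness t in F⊑Q i Fix

    IsChain : {I : Set} → (I → Subset) → Set
    IsChain F = ∀ i j → F i ⊑ F j ⊎ F j ⊑ F i

    module _ (Good : Subset → Set) {P₀ : Subset} (good₀ : Good P₀)
      (good-⋃ : {I : Set} (F : I → Subset) → I → IsChain F → (∀ i → Good (F i)) → Good (⋃ˢ F)) where

      private
        Larger : Subset → Set
        Larger P = Σ[ Q ∈ Subset ] (Good Q × P ⊑ Q × ¬ (Q ⊑ P))

        next : Subset → Subset
        next P with dec (Larger P)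
        ... | yes (Q , _) = Q
        ... | no _        = P

        next-good : ∀ {P} → Good P → Good (next P)
        next-good {P} gP with dec (Larger P)
        ... | yes (_ , gQ , _) = gQ
        ... | no _             = gP

        ⊑-next : ∀ P → P ⊑ next P
        ⊑-next P with dec (Larger P)
        ... | yes (_ , _ , P⊑Q , _) = P⊑Q
        ... | no _                  = id

        next-maximal : ∀ {P} → next P ⊑ P → ¬ Larger P
        next-maximal {P} n⊑P L with dec (Larger P)
        ... | yes (_ , _ , _ , Q⋢P) = Q⋢P n⊑P
        ... | no ¬L                 = ¬L L

        -- `lim` takes unions of arbitrary inhabited families; `tower-linear` shows afterwards that
        -- they are all unions of chains.
        data Tower : Subset → Set₁ where
          base : Tower P₀
          step : ∀ {P} → Tower P → Tower (next P)
          lim  : {I : Set} (F : I → Subset) → I → (∀ i → Tower (F i)) → Tower (⋃ˢ F)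

        base-⊑ : ∀ {P} → Tower P → P₀ ⊑ P
        base-⊑ base        = id
        base-⊑ (step t)    = ⊑-next _ ∘ base-⊑ t
        base-⊑ (lim F i t) = ⊑-⋃ˢ F i ∘ base-⊑ (t i)

        -- The extreme points of the Bourbaki-Witt argument: `next` never jumps past `C` from
        -- strictly below.
        Extreme : Subset → Set₁
        Extreme C = ∀ {P} → Tower P → P ⊑ C → ¬ (C ⊑ P) → next P ⊑ C

        -- Induction on the tower of `P`. A step taken strictly below `C` stays below by
        -- extremeness, and one taken at `C` reaches `next C`. A union is below `C` if all its
        -- members are; otherwise some member is already above `next C`.
        extreme-splits : ∀ {C P} → Tower C → Extreme C → Tower P → P ⊑ C ⊎ next C ⊑ P
        extreme-splits tC eC base = inj₁ (base-⊑ tC)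
        extreme-splits {C} tC eC (step {P} t) with extreme-splits tC eC t
        ... | inj₂ n⊑P = inj₂ (⊑-next P ∘ n⊑P)
        ... | inj₁ P⊑C with dec (C ⊑ P)
        ...   | no C⋢P  = inj₁ (eC t P⊑C C⋢P)
        ...   | yes C⊑P = inj₂ (subst (λ Q → next C ⊑ next Q) (⊑-antisym C⊑P P⊑C) id)
        extreme-splits {C} tC eC (lim F i t) with dec (∀ j → F j ⊑ C)
        ... | yes F⊑C = inj₁ (⋃ˢ-⊑ F F⊑C)
        ... | no ¬F⊑C with ¬∀⇒∃¬ ¬F⊑C
        ...   | j , Fj⋢C with extreme-splits tC eC (t j)
        ...     | inj₁ Fj⊑C = ⊥-elim (Fj⋢C Fj⊑C)
        ...     | inj₂ n⊑Fj = inj₂ (⊑-⋃ˢ F j ∘ n⊑Fj)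

        extreme : ∀ {C} → Tower C → Extreme C
        extreme base tP P⊑C C⋢P = ⊥-elim (C⋢P (base-⊑ tP))
        extreme (step {C} tC) {P} tP P⊑nC nC⋢P with extreme-splits tC (extreme tC) tP
        ... | inj₂ nC⊑P = ⊥-elim (nC⋢P nC⊑P)
        ... | inj₁ P⊑C with dec (C ⊑ P)
        ...   | no C⋢P  = ⊑-next C ∘ extreme tC tP P⊑C C⋢P
        ...   | yes C⊑P = subst (λ Q → next P ⊑ next Q) (⊑-antisym P⊑C C⊑P) id
        extreme (lim F i t) {P} tP P⊑⋃ ⋃⋢P with ¬∀⇒∃¬ {P = λ j → F j ⊑ P} (λ F⊑P → ⋃⋢P (⋃ˢ-⊑ F F⊑P))
        ... | j , Fj⋢P with extreme-splits (t j) (extreme (t j)) tP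
        ...   | inj₁ P⊑Fj = ⊑-⋃ˢ F j ∘ extreme (t j) tP P⊑Fj Fj⋢P
        ...   | inj₂ n⊑P  = ⊥-elim (Fj⋢P (n⊑P ∘ ⊑-next (F j)))

        tower-linear : ∀ {P Q} → Tower P → Tower Q → P ⊑ Q ⊎ Q ⊑ P
        tower-linear {Q = Q} tP tQ with extreme-splits tQ (extreme tQ) tP
        ... | inj₁ P⊑Q  = inj₁ P⊑Q
        ... | inj₂ nQ⊑P = inj₂ (nQ⊑P ∘ ⊑-next Q)

        tower-good : ∀ {P} → Tower P → Good P
        tower-good base        = good₀
        tower-good (step t)    = next-good (tower-good t)
        tower-good (lim F i t) =
          good-⋃ F i (λ j k → tower-linear (t j) (t k)) (λ j → tower-good (t j))

        -- `Tower` lives in `Set₁`; coding membership by a Boolean makes the stages an index type in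
        -- `Set`, so that `lim` applies to the family of all of them.
        Stage : Set
        Stage = Σ[ P ∈ Subset ] T ⌊ em {Tower P} ⌋

        top : Subset
        top = ⋃ˢ {Stage} proj₁

        top-tower : Tower top
        top-tower = lim proj₁ (P₀ , fromWitness base) (λ s → toWitness (proj₂ s))

      -- The successor of `top` is itself a stage, hence contained in `top`; since `next` enlarges
      -- every set that has a larger good one, `top` has none.
      zorn : Σ[ M ∈ Subset ] (P₀ ⊑ M × Good M × (∀ Q → Good Q → M ⊑ Q → Q ⊑ M))
      zorn = top , base-⊑ top-tower , tower-good top-tower , λ Q gQ M⊑Q → stable λ Q⋢M →
        next-maximal (⊑-⋃ˢ proj₁ (next top , fromWitness (step top-tower))) (Q , gQ , M⊑Q , Q⋢M)

  -- Extending partial orders on torsion-free abelian groups.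

  module OrderExtension (G : AbelianGroup 0ℓ 0ℓ) where
    open AbelianGroup G renaming
      ( _∙_ to infixl 6 _+_; ε to 0#; _⁻¹ to infix 8 -_; _-_ to infixl 6 _⊖_; refl to ≈-refl
      ; sym to ≈-sym; trans to ≈-trans
      ; ∙-cong to +-cong; ∙-congʳ to +-congʳ; ∙-congˡ to +-congˡ
      ; assoc to +-assoc; identityˡ to +-identityˡ; identityʳ to +-identityʳ; comm to +-comm; ⁻¹-cong to -‿cong )
    open AbelianGroupProperties G using (⁻¹-∙-comm; ⁻¹-involutive; ε⁻¹≈ε; inverseˡ-unique)
    open import Algebra.Properties.CommutativeSemigroup commutativeSemigroup using (interchange)
    open Mult commutativeMonoid using (×-congʳ; ×-homo-+; ×-assocˡ; ×-homo-1) renaming (_×_ to _·_)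
    open SetoidReasoning setoid
    open Zorn {Carrier}

    -- With 0 in `P`, which is carried separately, these are the sets of elements ≥ 0 of a
    -- translation-invariant partial order. They are not the topological cones `cone κ t`.
    record IsCone (P : Carrier → Set) : Set where
      field
        ∈-resp   : ∀ {x y} → x ≈ y → P x → P y
        +-closed : ∀ {x y} → P x → P y → P (x + y)
        antisym  : ∀ {x} → P x → P (- x) → x ≈ 0#

    TorsionFree : Set
    TorsionFree = ∀ n x → ℕ.suc n · x ≈ 0# → x ≈ 0#

    ·-neg : ∀ n x → n · (- x) ≈ - (n · x)
    ·-neg zero      x = ≈-sym ε⁻¹≈ε
    ·-neg (ℕ.suc n) x = ≈-trans (+-congˡ (·-neg n x)) (⁻¹-∙-comm x (n · x))

    module _ {P : Carrier → Set} (coneP : IsCone P) (0∈P : P 0#) where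
      open IsCone coneP

      ·-closed : ∀ n {x} → P x → P (n · x)
      ·-closed zero      Px = 0∈P
      ·-closed (ℕ.suc n) Px = +-closed Px (·-closed n Px)

      Adjoin : Carrier → Carrier → Set
      Adjoin g x = Σ[ p ∈ Carrier ] Σ[ n ∈ ℕ ] (P p × x ≈ p + n · g)

      -- If x and - x both lie in the enlarged set and g occurs in at least one of them, their sum
      -- being 0 puts a positive multiple of - g into `P`.
      adjoin-isCone : ∀ g → (∀ n → ¬ P (ℕ.suc n · (- g))) → IsCone (Adjoin g)
      adjoin-isCone g ¬neg = record
        { ∈-resp   = λ { x≈y (p , n , Pp , e) → p , n , Pp , ≈-trans (≈-sym x≈y) e }
        ; +-closed = λ { (p , n , Pp , e) (q , m , Pq , e′) →
            p + q , n ℕ.+ m , +-closed Pp Pq , ≈-trans (+-cong e e′) (collect p q n m) }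
        ; antisym  = anti
        }
        where
        collect : ∀ p q n m → (p + n · g) + (q + m · g) ≈ (p + q) + (n ℕ.+ m) · g
        collect p q n m = ≈-trans (interchange p (n · g) q (m · g)) (+-congˡ (≈-sym (×-homo-+ g n m)))

        cancels : ∀ n m {x p q k} → P p → P q → x ≈ p + n · g → - x ≈ q + m · g → ¬ (n ℕ.+ m ≡ ℕ.suc k)
        cancels n m {x} {p} {q} {k} Pp Pq e e′ n+m = ¬neg k (∈-resp (begin
          p + q                ≈⟨ inverseˡ-unique (p + q) (ℕ.suc k · g) sum≈0 ⟩
          - (ℕ.suc k · g)      ≈⟨ ·-neg (ℕ.suc k) g ⟨
          ℕ.suc k · (- g)      ∎) (+-closed Pp Pq))
          where
          sum≈0 : (p + q) + ℕ.suc k · g ≈ 0#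
          sum≈0 = begin
            (p + q) + ℕ.suc k · g       ≡⟨ cong (λ j → (p + q) + j · g) n+m ⟨
            (p + q) + (n ℕ.+ m) · g     ≈⟨ collect p q n m ⟨
            (p + n · g) + (q + m · g)   ≈⟨ +-cong e e′ ⟨
            x + - x                     ≈⟨ inverseʳ x ⟩
            0#                          ∎

        anti : ∀ {x} → Adjoin g x → Adjoin g (- x) → x ≈ 0#
        anti (p , zero , Pp , e) (q , zero , Pq , e′) =
          antisym (∈-resp (≈-sym (≈-trans e (+-identityʳ p))) Pp) (∈-resp (≈-sym (≈-trans e′ (+-identityʳ q))) Pq)
        anti (_ , zero , Pp , e) (_ , ℕ.suc m , Pq , e′)    = ⊥-elim (cancels zero (ℕ.suc m) Pp Pq e e′ refl)
        anti (_ , ℕ.suc n , Pp , e) (_ , m , Pq , e′)       = ⊥-elim (cancels (ℕ.suc n) m Pp Pq e e′ refl)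

    module _ {P₀ : Carrier → Set} (cone₀ : IsCone P₀) (0∈P₀ : P₀ 0#) (torsionFree : TorsionFree) where
      private
        Good : Subset → Set
        Good P = IsCone (T ∘ P)

        compr : (Carrier → Set) → Subset
        compr Q x = ⌊ dec (Q x) ⌋

        good-compr : ∀ {Q} → IsCone Q → Good (compr Q)
        good-compr coneQ = record
          { ∈-resp   = λ x≈y t → fromWitness (∈-resp x≈y (toWitness t))
          ; +-closed = λ t u → fromWitness (+-closed (toWitness t) (toWitness u))
          ; antisym  = λ t u → antisym (toWitness t) (toWitness u)
          }
          where open IsCone coneQ

        good-⋃ : {I : Set} (F : I → Subset) → I → IsChain F → (∀ i → Good (F i)) → Good (⋃ˢ F)
        good-⋃ F _ chain good = record
          { ∈-resp   = λ x≈y t → let i , Fix = toWitness t in fromWitness (i , IsCone.∈-resp (good i) x≈y Fix)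
          ; +-closed = λ t u → let i , Fix , Fiy = common t u in fromWitness (i , IsCone.+-closed (good i) Fix Fiy)
          ; antisym  = λ t u → let i , Fix , Fiy = common t u in IsCone.antisym (good i) Fix Fiy
          }
          where
          common : ∀ {x y} → T (⋃ˢ F x) → T (⋃ˢ F y) → ∃[ i ] (T (F i x) × T (F i y))
          common t u with toWitness t | toWitness u
          ... | i , Fix | j , Fjy = [ (λ Fi⊑Fj → j , Fi⊑Fj Fix , Fjy) , (λ Fj⊑Fi → i , Fix , Fj⊑Fi Fjy) ]′ (chain i j)

      -- If g and - g both fail to be adjoined to a maximal cone, then it
      -- contains positive multiples of both, against torsion-freeness.
      extend-to-total : Σ[ P ∈ (Carrier → Set) ] ((∀ {x} → P₀ x → P x) × IsCone P × (∀ x → P x ⊎ P (- x)))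
      extend-to-total with zorn Good (good-compr cone₀) good-⋃
      ... | M , P₀⊑M , coneM , maximal = T ∘ M , (λ p → P₀⊑M (fromWitness p)) , coneM , total
        where
        open IsCone coneM

        0∈M : T (M 0#)
        0∈M = P₀⊑M (fromWitness 0∈P₀)

        multiple : ∀ g → ¬ T (M g) → ∃[ n ] T (M (ℕ.suc n · (- g)))
        multiple g g∉M = stable λ none → g∉M
          (maximal (compr (Adjoin coneM 0∈M g))
            (good-compr (adjoin-isCone coneM 0∈M g (λ n t → none (n , t))))
            (λ {x} t → fromWitness (x , 0 , t , ≈-sym (+-identityʳ x)))
            (fromWitness (0# , 1 , 0∈M , ≈-sym (≈-trans (+-identityˡ (1 · g)) (×-homo-1 g)))))

        total : ∀ x → T (M x) ⊎ T (M (- x))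
        total x with dec (T (M x)) | dec (T (M (- x)))
        ... | yes p | _     = inj₁ p
        ... | no _  | yes p = inj₂ p
        ... | no ¬p | no ¬q with multiple x ¬p | multiple (- x) ¬q
        ...   | n , t | m , u = ⊥-elim (¬p (∈-resp (≈-sym x≈0) 0∈M))
          where
          -- A common multiple: `ℕ.suc k` computes to `ℕ.suc n ℕ.* ℕ.suc m`.
          k : ℕ
          k = m ℕ.+ n ℕ.* ℕ.suc m

          pos : T (M (ℕ.suc k · x))
          pos = ∈-resp (≈-trans (×-assocˡ _ (ℕ.suc n) (ℕ.suc m)) (×-congʳ (ℕ.suc k) (⁻¹-involutive x)))
            (·-closed coneM 0∈M (ℕ.suc n) u)

          neg : T (M (- (ℕ.suc k · x)))
          neg = ∈-resp (begin
            ℕ.suc m · ℕ.suc n · (- x)        ≈⟨ ×-assocˡ _ (ℕ.suc m) (ℕ.suc n) ⟩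
            (ℕ.suc m ℕ.* ℕ.suc n) · (- x)    ≡⟨ cong (_· (- x)) (*-comm (ℕ.suc m) (ℕ.suc n)) ⟩
            ℕ.suc k · (- x)                  ≈⟨ ·-neg (ℕ.suc k) x ⟩
            - (ℕ.suc k · x)                  ∎) (·-closed coneM 0∈M (ℕ.suc m) t)

          x≈0 : x ≈ 0#
          x≈0 = torsionFree k x (antisym pos neg)

-- Positions in κ and injections into λ.

module Construction (em : ExcludedMiddle (suc 0ℓ)) (ext : Extensionality (suc 0ℓ) (suc 0ℓ))
  (κ lam : Ordinal) (κ-infinite : IsInfiniteCardinal κ) (κ≼λ : ∣ κ ∣ ≼ ∣ lam ∣) (regular : IsRegular κ)
  (coding : Seq< κ ∣ lam ∣ ⤖ ∣ lam ∣) (λ≺X : ∣ lam ∣ ≺ Seqκ κ ∣ lam ∣) where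

  open Choice em ext
  open Ordinal κ using (_<_; compare; <-irrelevant)
  open IsStrictTotalOrder (Ordinal.isStrictTotalOrder κ) using () renaming (trans to <-trans; irrefl to <-irrefl)

  K L X : Set
  K = ∣ κ ∣
  L = ∣ lam ∣
  X = Seqκ κ L

  κ-point : ∃[ q ] Segment κ q
  κ-point with compare (k 0) (k 1)
    where k = Injection.to (proj₂ κ-infinite)
  ... | tri< p _ _ = _ , _ , p
  ... | tri> _ _ p = _ , _ , p
  ... | tri≈ _ e _ with Injection.injective (proj₂ κ-infinite) e
  ...   | ()

  -- If `a` were the largest element, a constant map on a nonempty initial segment would be cofinal,
  -- against regularity.
  above : ∀ a → ∃[ b ] a < b
  above a = stable λ none →
    regular (proj₁ κ-point) (λ _ → a) (λ b → proj₂ κ-point , λ a<b → none (b , a<b))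

  above₂ : ∀ a b → ∃[ c ] (a < c × b < c)
  above₂ a b with compare a b | above a | above b
  ... | tri< a<b _ _  | _       | c , b<c = c , <-trans a<b b<c , b<c
  ... | tri≈ _ refl _ | c , a<c | _       = c , a<c , a<c
  ... | tri> _ _ b<a  | c , a<c | _       = c , a<c , <-trans b<a a<c

  -- Some three increasing positions, not necessarily the first three; the numerals only indicate
  -- their order.
  0κ 1κ 2κ : K
  0κ = proj₁ κ-point
  1κ = proj₁ (above 0κ)
  2κ = proj₁ (above 1κ)

  ι : K → L
  ι = Injection.to κ≼λ

  ι-injective : ∀ {a b} → ι a ≡ ι b → a ≡ b
  ι-injective = Injection.injective κ≼λ

  ι0≢ι1 : ι 0κ ≢ ι 1κ
  ι0≢ι1 e = <-irrefl (ι-injective e) (proj₂ (above 0κ))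

  code : Seq< κ L → L
  code = Bijection.to coding

  code-injective : ∀ {s t} → code s ≡ code t → s ≡ t
  code-injective = Bijection.injective coding

  extend : Seq< κ L → X
  extend (a , s) i with dec (i < a)
  ... | yes i<a = s (i , i<a)
  ... | no _    = ι 0κ

  extend-∈ : ∀ t → extend t ∈ cone κ t
  extend-∈ (a , s) (i , i<a) with dec (i < a)
  ... | yes i<a′ = cong (λ p → s (i , p)) (<-irrelevant i<a′ i<a)
  ... | no i≮a   = ⊥-elim (i≮a i<a)

  -- Comparing the total extensions avoids taking apart an equality of dependent pairs.
  code-agree : ∀ {a s t} → code (a , s) ≡ code (a , t) → ∀ i → s i ≡ t i
  code-agree {a} {s} {t} e i = trans (sym (extend-∈ (a , s) i))
    (trans (cong (λ u → extend u (proj₁ i)) (code-injective e)) (extend-∈ (a , t) i))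

  -- λ · λ = λ obtained from the coding of short sequences: the sequence has length `2κ`, with `i`
  -- at `0κ` and `j` everywhere else, and is read back at `0κ` and `1κ`.
  pair : L → L → L
  pair i j = code (2κ , λ p → if ⌊ dec (proj₁ p ≡ 0κ) ⌋ then i else j)

  pair-injective : ∀ {i j i′ j′} → pair i j ≡ pair i′ j′ → i ≡ i′ × j ≡ j′
  pair-injective e = first (code-agree e (0κ , <-trans (proj₂ (above 0κ)) (proj₂ (above 1κ))))
                   , second (code-agree e (1κ , proj₂ (above 1κ)))
    where
    first : ∀ {i i′ j j′ : L} →
      (if ⌊ dec (0κ ≡ 0κ) ⌋ then i else j) ≡ (if ⌊ dec (0κ ≡ 0κ) ⌋ then i′ else j′) → i ≡ i′
    first e with dec (0κ ≡ 0κ)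
    ... | yes _ = e
    ... | no ¬r = ⊥-elim (¬r refl)

    second : ∀ {i i′ j j′ : L} →
      (if ⌊ dec (1κ ≡ 0κ) ⌋ then i else j) ≡ (if ⌊ dec (1κ ≡ 0κ) ⌋ then i′ else j′) → j ≡ j′
    second e with dec (1κ ≡ 0κ)
    ... | yes r = ⊥-elim (<-irrefl (sym r) (proj₂ (above 0κ)))
    ... | no _  = e

  -- Composing with `pair (ι 0κ)` or with `pair (ι 1κ)` gives two disjoint ranges, so at least one
  -- of them misses the next value `v`.
  avoiding : (V : List L) →
    Σ[ e ∈ (L → L) ] ((∀ {i j} → e i ≡ e j → i ≡ j) × All (λ v → ∀ j → e j ≢ v) V)
  avoiding [] = id , id , []
  avoiding (v ∷ V) with avoiding V
  ... | e , e-inj , e∉V with dec (∃[ j ] e (pair (ι 0κ) j) ≡ v)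
  ...   | no ¬v = e ∘ pair (ι 0κ) , proj₂ ∘ pair-injective ∘ e-inj
                , (λ j ev → ¬v (j , ev)) ∷ All.map (λ e∉ j → e∉ _) e∉V
  ...   | yes (j₀ , ev₀) = e ∘ pair (ι 1κ) , proj₂ ∘ pair-injective ∘ e-inj
                , (λ j ev → ι0≢ι1 (proj₁ (pair-injective (e-inj (trans ev₀ (sym ev))))))
                ∷ All.map (λ e∉ j → e∉ _) e∉V

  -- Null sets.

  -- Q holds outside a set of at most λ points.
  record AE (Q : X → Set) : Set where
    constructor almostEverywhere
    field
      embed           : X → L
      embed-injective : ∀ {x y} → ¬ Q x → ¬ Q y → embed x ≡ embed y → x ≡ y

  open AE

  module _ {Q R : X → Set} where
    AE-map : (∀ x → Q x → R x) → AE Q → AE R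
    AE-map Q⊆R (almostEverywhere e inj) = almostEverywhere e λ ¬Rx ¬Ry → inj (¬Rx ∘ Q⊆R _) (¬Ry ∘ Q⊆R _)

  AE-always : {Q : X → Set} → (∀ x → Q x) → AE Q
  AE-always q = almostEverywhere (λ _ → ι 0κ) λ ¬Qx _ _ → ⊥-elim (¬Qx (q _))

  -- An exceptional point is coded by an index at which it fails, paired with its code as an
  -- exception there.
  AE-⋂ : {I : Set} {Q : I → X → Set} → I ≼ L → (∀ i → AE (Q i)) → AE (λ x → ∀ i → Q i x)
  AE-⋂ {I} {Q} I≼L ae = almostEverywhere e λ {x} {y} → e-inj x y
    where
    e : X → L
    e x with dec (∃[ i ] ¬ Q i x)
    ... | yes (i , _) = pair (Injection.to I≼L i) (embed (ae i) x)
    ... | no _        = ι 0κ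

    e-inj : ∀ x y → ¬ (∀ i → Q i x) → ¬ (∀ i → Q i y) → e x ≡ e y → x ≡ y
    e-inj x y ¬Qx ¬Qy ex≡ey with dec (∃[ i ] ¬ Q i x) | dec (∃[ i ] ¬ Q i y)
    ... | no all | _      = ⊥-elim (¬Qx λ i → stable λ ¬q → all (i , ¬q))
    ... | yes _  | no all = ⊥-elim (¬Qy λ i → stable λ ¬q → all (i , ¬q))
    ... | yes (i , ¬Qix) | yes (j , ¬Qjy) with pair-injective ex≡ey
    ...   | i≡j , eq with Injection.injective I≼L i≡j
    ...     | refl = embed-injective (ae i) ¬Qix ¬Qjy eq

  AE-× : {Q R : X → Set} → AE Q → AE R → AE (λ x → Q x × R x)
  AE-× {Q} {R} aeQ aeR = AE-map (λ x q → q true , q false)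
    (AE-⋂ {Q = λ b x → if b then Q x else R x} Bool≼L λ { true → aeQ ; false → aeR })
    where
    Bool≼L : Bool ≼ L
    Bool≼L = mk↣ {to = λ b → if b then ι 0κ else ι 1κ} λ
      { {true} {true} _ → refl ; {true} {false} e → ⊥-elim (ι0≢ι1 e)
      ; {false} {true} e → ⊥-elim (ι0≢ι1 (sym e)) ; {false} {false} _ → refl }

  AE-zip : {Q R T : X → Set} → (∀ x → Q x → R x → T x) → AE Q → AE R → AE T
  AE-zip f aeQ aeR = AE-map (λ x (q , r) → f x q r) (AE-× aeQ aeR)

  Avoids : List (K × L) → X → Set
  Avoids l x = All (λ (i , j) → x i ≢ j) l

  Above : K → List (K × L) → Set
  Above a = All (λ (i , _) → ¬ (i < a))

  -- Coding x ↾ b at position a, and the values of x with an injection that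
  -- avoids l, embeds X into the points of the cone that avoid l.
  cone-avoiding-nonnull : ∀ t l → Above (proj₁ t) l → ¬ AE (λ x → Avoids l x → ¬ (x ∈ cone κ t))
  cone-avoiding-nonnull (a , s) l a≤l (almostEverywhere null null-inj) =
    proj₂ λ≺X (mk↣ {to = null ∘ Φ} λ {x} {y} eq → Φ-injective x y (cong-app (null-inj (hits x) (hits y) eq)))
    where
    open import Relation.Binary.PropositionalEquality using (isEquivalence; cong-app)
    -- `b` lies strictly above `a`, so that the coded restriction of x also records the coordinate
    -- at `a` itself, which `Φ` overwrites.
    b : K
    b = proj₁ (above a)

    e : L → L
    e = proj₁ (avoiding (map proj₂ l))

    e-inj : ∀ {i j} → e i ≡ e j → i ≡ j
    e-inj = proj₁ (proj₂ (avoiding (map proj₂ l)))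

    Φ : X → X
    Φ x i with compare i a
    ... | tri< i<a _ _ = s (i , i<a)
    ... | tri≈ _ _ _   = e (code (b , x ∘ proj₁))
    ... | tri> _ _ _   = e (x i)

    Φ-∈ : ∀ x → Φ x ∈ cone κ (a , s)
    Φ-∈ x (i , i<a) with compare i a
    ... | tri< i<a′ _ _ = cong (λ p → s (i , p)) (<-irrelevant i<a′ i<a)
    ... | tri≈ i≮a _ _  = ⊥-elim (i≮a i<a)
    ... | tri> i≮a _ _  = ⊥-elim (i≮a i<a)

    Φ-avoids : ∀ x → Avoids l (Φ x)
    Φ-avoids x = All.zipWith (λ { {i , j} (i≮a , e≢j) → at i≮a e≢j })
      (a≤l , All.map⁻ (proj₂ (proj₂ (avoiding (map proj₂ l)))))
      where
      at : ∀ {i j} → ¬ (i < a) → (∀ k → e k ≢ j) → Φ x i ≢ j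
      at {i} i≮a e≢j with compare i a
      ... | tri< i<a _ _ = ⊥-elim (i≮a i<a)
      ... | tri≈ _ _ _   = e≢j _
      ... | tri> _ _ _   = e≢j _

    hits : ∀ x → ¬ (Avoids l (Φ x) → ¬ (Φ x ∈ cone κ (a , s)))
    hits x ¬hit = ¬hit (Φ-avoids x) (Φ-∈ x)

    Φ-at-a : ∀ x → Φ x a ≡ e (code (b , x ∘ proj₁))
    Φ-at-a x with compare a a
    ... | tri< _ a≢a _ = ⊥-elim (a≢a refl)
    ... | tri≈ _ _ _   = refl
    ... | tri> _ a≢a _ = ⊥-elim (a≢a refl)

    Φ-above : ∀ x {i} → a < i → Φ x i ≡ e (x i)
    Φ-above x {i} a<i with compare i a
    ... | tri< _ _ a≮i = ⊥-elim (a≮i a<i)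
    ... | tri≈ _ _ a≮i = ⊥-elim (a≮i a<i)
    ... | tri> _ _ _   = refl

    Φ-injective : ∀ x y → (∀ i → Φ x i ≡ Φ y i) → x ≡ y
    Φ-injective x y eq = funext λ i → agree i
      where
      below-b : ∀ i → i < b → x i ≡ y i
      below-b i i<b = code-agree (e-inj (trans (sym (Φ-at-a x)) (trans (eq a) (Φ-at-a y)))) (i , i<b)

      agree : ∀ i → x i ≡ y i
      agree i with compare i a
      ... | tri< i<a _ _  = below-b i (<-trans i<a (proj₂ (above a)))
      ... | tri≈ _ refl _ = below-b i (proj₂ (above a))
      ... | tri> _ _ a<i  = e-inj (trans (sym (Φ-above x a<i)) (trans (eq i) (Φ-above y a<i)))

  -- The group of integer-valued functions modulo null sets.

  F : Set
  F = X → ℤ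

  infix 4 _≈_
  _≈_ : F → F → Set
  f ≈ g = AE (λ x → f x ≡ g x)

  ≈-refl : ∀ {f} → f ≈ f
  ≈-refl = AE-always (λ _ → refl)

  ≈-sym : ∀ {f g} → f ≈ g → g ≈ f
  ≈-sym = AE-map (λ _ → sym)

  ≈-trans : ∀ {f g h} → f ≈ g → g ≈ h → f ≈ h
  ≈-trans = AE-zip (λ _ → trans)

  infixl 6 _⊕_ _⊖_
  _⊕_ _⊖_ : F → F → F
  (f ⊕ g) x = f x ℤ.+ g x
  (f ⊖ g) x = f x ℤ.- g x

  infix 8 ⊝_
  ⊝_ : F → F
  (⊝ f) x = ℤ.- f x

  𝟎 : F
  𝟎 _ = 0ℤ

  functionGroup : AbelianGroup 0ℓ 0ℓ
  functionGroup = record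
    { Carrier = F ; _≈_ = _≈_ ; _∙_ = _⊕_ ; ε = 𝟎 ; _⁻¹ = ⊝_
    ; isAbelianGroup = record
      { isGroup = record
        { isMonoid = record
          { isSemigroup = record
            { isMagma = record
              { isEquivalence = record { refl = ≈-refl ; sym = ≈-sym ; trans = ≈-trans }
              ; ∙-cong = AE-zip (λ _ → cong₂ ℤ._+_)
              }
            ; assoc = λ f g h → AE-always (λ x → ℤ.+-assoc (f x) (g x) (h x))
            }
          ; identity = (λ f → AE-always (λ x → ℤ.+-identityˡ (f x)))
                     , (λ f → AE-always (λ x → ℤ.+-identityʳ (f x)))
          }
        ; inverse = (λ f → AE-always (λ x → ℤ.+-inverseˡ (f x)))
                  , (λ f → AE-always (λ x → ℤ.+-inverseʳ (f x)))
        ; ⁻¹-cong = AE-map (λ _ → cong (ℤ.-_))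
        }
      ; comm = λ f g → AE-always (λ x → ℤ.+-comm (f x) (g x))
      }
    }

  open OrderExtension functionGroup using (IsCone; TorsionFree; extend-to-total)
  open import Algebra.Definitions.RawMonoid (AbelianGroup.rawMonoid functionGroup) using () renaming (_×_ to _·_)

  ·-pointwise : ∀ n f x → (n · f) x ≡ (+ n) ℤ.* f x
  ·-pointwise zero        f x = refl
  ·-pointwise (ℕ.suc n) f x =
    trans (cong (λ z → f x ℤ.+ z) (·-pointwise n f x)) (sym (ℤ.suc-* (+ n) (f x)))

  torsionFree : TorsionFree
  torsionFree n f = AE-map λ x nfx≡0 →
    [ (λ ()) , id ]′ (ℤ.i*j≡0⇒i≡0∨j≡0 (+ ℕ.suc n) (trans (sym (·-pointwise (ℕ.suc n) f x)) nfx≡0))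

  -- The partial order: nonnegative and dominant functions.

  Nonneg : F → Set
  Nonneg f = AE (λ x → 0ℤ ℤ.≤ f x)

  -- Outside finitely many coordinate conditions at positions ≥ lh t, hence on
  -- most of the cone of t, f is nonnegative, and at least 1 on that cone.
  -- This makes cones infinitesimal relative to cones of shorter sequences.
  Dominant : F → Set
  Dominant f = Σ[ t ∈ Seq< κ L ] Σ[ l ∈ List (K × L) ]
    (Above (proj₁ t) l × AE (λ x → Avoids l x → 0ℤ ℤ.≤ f x × (x ∈ cone κ t → 1ℤ ℤ.≤ f x)))

  Positive : F → Set
  Positive f = Nonneg f ⊎ Dominant f

  dominant-resp : ∀ {f g} → f ≈ g → Dominant f → Dominant g
  dominant-resp f≈g (t , l , al , ae) =
    t , l , al , AE-zip (λ x fx≡gx → subst (λ z → Avoids l x → 0ℤ ℤ.≤ z × (x ∈ cone κ t → 1ℤ ℤ.≤ z)) fx≡gx) f≈g ae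

  dominant-+-nonneg : ∀ {f g} → Dominant f → Nonneg g → Dominant (f ⊕ g)
  dominant-+-nonneg (t , l , al , ae) ng = t , l , al , AE-zip
    (λ x p 0≤gx av → ℤ.+-mono-≤ (proj₁ (p av)) 0≤gx , λ x∈t → ℤ.+-mono-≤ (proj₂ (p av) x∈t) 0≤gx) ae ng

  -- The shorter sequence survives: the conditions for `g` sit at positions that are also beyond the
  -- length of `t`, and where they hold `g` adds something nonnegative.
  dominant-+-shorter : ∀ {f g} (f⁺ : Dominant f) (g⁺ : Dominant g) →
    ¬ (proj₁ (proj₁ g⁺) < proj₁ (proj₁ f⁺)) → Dominant (f ⊕ g)
  dominant-+-shorter {f} {g} (t@(a , _) , l , al , ae) (t′@(a′ , _) , l′ , al′ , ae′) a′≮a =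
    t , l ++ l′ , All.++⁺ al (All.map (λ i≮a′ i<a → i≮a′ (<-≤ i<a)) al′) , AE-zip
      (λ x p q av → let pl = p (All.++⁻ˡ l av) ; ql = proj₁ (q (All.++⁻ʳ l av)) in
        ℤ.+-mono-≤ (proj₁ pl) ql , λ x∈t → ℤ.+-mono-≤ (proj₂ pl x∈t) ql) ae ae′
    where
    <-≤ : ∀ {i} → i < a → i < a′
    <-≤ {i} i<a with compare a a′
    ... | tri< a<a′ _ _ = <-trans i<a a<a′
    ... | tri≈ _ refl _ = i<a
    ... | tri> _ _ a′<a = ⊥-elim (a′≮a a′<a)

  ⊕-comm : ∀ f g → f ⊕ g ≈ g ⊕ f
  ⊕-comm = AbelianGroup.comm functionGroup

  dominant-+ : ∀ {f g} → Dominant f → Dominant g → Dominant (f ⊕ g)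
  dominant-+ {f} {g} f⁺ g⁺ with compare (proj₁ (proj₁ f⁺)) (proj₁ (proj₁ g⁺))
  ... | tri< _ _ g≮f = dominant-+-shorter f⁺ g⁺ g≮f
  ... | tri≈ _ _ g≮f = dominant-+-shorter f⁺ g⁺ g≮f
  ... | tri> f≮g _ _ = dominant-resp (⊕-comm g f) (dominant-+-shorter g⁺ f⁺ f≮g)

  -- Otherwise the points of the cone of `t` that avoid `l`, where f is at least 1, would form a
  -- null set.
  dominant-nonnull : ∀ {f} → Dominant f → ¬ (f ≈ 𝟎)
  dominant-nonnull (t , l , al , ae) f≈0 = cone-avoiding-nonnull t l al (AE-zip
    (λ x p fx≡0 av x∈t → case (subst (1ℤ ℤ.≤_) fx≡0 (proj₂ (p av) x∈t))) ae f≈0)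
    where
    case : ¬ (1ℤ ℤ.≤ 0ℤ)
    case (ℤ.+≤+ ())

  positive-isCone : IsCone Positive
  positive-isCone = record
    { ∈-resp   = λ
      { f≈g (inj₁ f⁺) → inj₁ (AE-zip (λ x → subst (0ℤ ℤ.≤_)) f≈g f⁺)
      ; f≈g (inj₂ f⁺) → inj₂ (dominant-resp f≈g f⁺) }
    ; +-closed = plus
    ; antisym  = anti
    }
    where
    plus : ∀ {f g} → Positive f → Positive g → Positive (f ⊕ g)
    plus (inj₁ f⁺) (inj₁ g⁺) = inj₁ (AE-zip (λ x → ℤ.+-mono-≤) f⁺ g⁺)
    plus {f} {g} (inj₁ f⁺) (inj₂ g⁺) = inj₂ (dominant-resp (⊕-comm g f) (dominant-+-nonneg g⁺ f⁺))
    plus (inj₂ f⁺) (inj₁ g⁺) = inj₂ (dominant-+-nonneg f⁺ g⁺)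
    plus (inj₂ f⁺) (inj₂ g⁺) = inj₂ (dominant-+ f⁺ g⁺)

    cancel : ∀ f → f ⊕ (⊝ f) ≈ 𝟎
    cancel f = AE-always (λ x → ℤ.+-inverseʳ (f x))

    anti : ∀ {f} → Positive f → Positive (⊝ f) → f ≈ 𝟎
    anti {f} (inj₁ f⁺) (inj₁ g⁺) = AE-zip (λ x 0≤fx 0≤-fx →
      ℤ.≤-antisym (subst (ℤ._≤ 0ℤ) (ℤ.neg-involutive (f x)) (ℤ.neg-mono-≤ 0≤-fx)) 0≤fx) f⁺ g⁺
    -- As soon as one of the two is dominant, so is the sum of `f` and its negative, although that
    -- sum is 0.
    anti {f} (inj₂ f⁺) (inj₁ g⁺) = ⊥-elim (dominant-nonnull (dominant-+-nonneg f⁺ g⁺) (cancel f))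
    anti {f} (inj₂ f⁺) (inj₂ g⁺) = ⊥-elim (dominant-nonnull (dominant-+ f⁺ g⁺) (cancel f))
    anti {f} (inj₁ f⁺) (inj₂ g⁺) = ⊥-elim (dominant-nonnull (dominant-+-nonneg g⁺ f⁺)
      (≈-trans (⊕-comm (⊝ f) f) (cancel f)))

  positive-𝟎 : Positive 𝟎
  positive-𝟎 = inj₁ (AE-always (λ _ → ℤ.≤-refl))

  -- The total order.

  private
    extension = extend-to-total positive-isCone positive-𝟎 torsionFree

  opaque
    P : F → Set
    P = proj₁ extension

    positive⇒P : ∀ {f} → Positive f → P f
    positive⇒P = proj₁ (proj₂ extension)

    P-isCone : IsCone P
    P-isCone = proj₁ (proj₂ (proj₂ extension))

    P-total : ∀ f → P f ⊎ P (⊝ f)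
    P-total = proj₂ (proj₂ (proj₂ extension))

  open IsCone P-isCone

  infix 4 _≲_

  opaque
    _≲_ : F → F → Set
    f ≲ g = P (g ⊖ f)

    ≲-reflexive : ∀ {f g} → f ≈ g → f ≲ g
    ≲-reflexive f≈g = positive⇒P (inj₁ (AE-map
      (λ x fx≡gx → ℤ.≤-reflexive (sym (ℤ.i≡j⇒i-j≡0 (sym fx≡gx)))) f≈g))

    ≤⇒≲ : ∀ {f g} → (∀ x → f x ℤ.≤ g x) → f ≲ g
    ≤⇒≲ f≤g = positive⇒P (inj₁ (AE-always (λ x → ℤ.i≤j⇒0≤j-i (f≤g x))))

    ≲-trans : ∀ {f g h} → f ≲ g → g ≲ h → f ≲ h
    ≲-trans {f} {g} {h} p q = ∈-resp (AE-always (λ x → telescope (f x) (g x) (h x))) (+-closed p q)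
      where
      telescope : ∀ i j k → (j ℤ.- i) ℤ.+ (k ℤ.- j) ≡ k ℤ.- i
      telescope = solve-∀

    ≲-resp-≈ : ∀ {f f′ g g′} → f ≈ f′ → g ≈ g′ → f ≲ g → f′ ≲ g′
    ≲-resp-≈ f≈f′ g≈g′ f≲g = ∈-resp
      (AE-zip (λ _ fx≡f′x gx≡g′x → cong₂ ℤ._-_ gx≡g′x fx≡f′x) f≈f′ g≈g′) f≲g

    ≲-antisym : ∀ {f g} → f ≲ g → g ≲ f → f ≈ g
    ≲-antisym {f} {g} p q = AE-map (λ x d≡0 → sym (ℤ.i-j≡0⇒i≡j (g x) (f x) d≡0))
      (antisym p (∈-resp (AE-always (λ x → flip-⊖ (f x) (g x))) q))
      where
      flip-⊖ : ∀ i j → i ℤ.- j ≡ ℤ.- (j ℤ.- i)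
      flip-⊖ = solve-∀

    ≲-total : ∀ f g → f ≲ g ⊎ g ≲ f
    ≲-total f g =
      [ inj₁ , (λ p → inj₂ (∈-resp (AE-always (λ x → flip-⊖ (f x) (g x))) p)) ]′ (P-total (g ⊖ f))
      where
      flip-⊖ : ∀ i j → ℤ.- (j ℤ.- i) ≡ i ℤ.- j
      flip-⊖ = solve-∀

    ⊕-mono : ∀ {f f′ g g′} → f ≲ f′ → g ≲ g′ → f ⊕ g ≲ f′ ⊕ g′
    ⊕-mono {f} {f′} {g} {g′} p q =
      ∈-resp (AE-always (λ x → regroup (f x) (f′ x) (g x) (g′ x))) (+-closed p q)
      where
      regroup : ∀ i i′ j j′ → (i′ ℤ.- i) ℤ.+ (j′ ℤ.- j) ≡ (i′ ℤ.+ j′) ℤ.- (i ℤ.+ j)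
      regroup = solve-∀

    -- Dominance gives strict inequality: with the reverse inequality, antisymmetry would make the
    -- difference null.
    dominant⇒≴ : ∀ {f g} → Dominant (g ⊖ f) → ¬ (g ≲ f)
    dominant⇒≴ {f} {g} d g≲f = dominant-nonnull d
      (AE-map (λ x fx≡gx → ℤ.i≡j⇒i-j≡0 (sym fx≡gx)) (≲-antisym {f} {g} (positive⇒P (inj₂ d)) g≲f))

    dominant⇒≲ : ∀ {f g} → Dominant (g ⊖ f) → f ≲ g
    dominant⇒≲ d = positive⇒P (inj₂ d)

  -- Indicator functions.

  open Representative _≈_ ≈-refl ≈-sym ≈-trans

  ind : Pred X 0ℓ → F
  ind A x = if ⌊ dec (A x) ⌋ then 1ℤ else 0ℤ

  ind-∈ : ∀ A {x} → x ∈ A → ind A x ≡ 1ℤ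
  ind-∈ A {x} x∈A with dec (A x)
  ... | yes _  = refl
  ... | no x∉A = ⊥-elim (x∉A x∈A)

  ind-∉ : ∀ A {x} → ¬ x ∈ A → ind A x ≡ 0ℤ
  ind-∉ A {x} x∉A with dec (A x)
  ... | yes x∈A = ⊥-elim (x∉A x∈A)
  ... | no _    = refl

  ind-∅ : ∀ x → ind ∅ x ≡ 0ℤ
  ind-∅ x = ind-∉ ∅ {x} λ ()

  ind-≡⇒∈ : ∀ A B {x} → ind A x ≡ ind B x → x ∈ A → x ∈ B
  ind-≡⇒∈ A B eq x∈A = stable λ x∉B → 1≢0 (trans (sym (ind-∈ A x∈A)) (trans eq (ind-∉ B x∉B)))
    where
    1≢0 : 1ℤ ≢ 0ℤ
    1≢0 ()

  ∈⇔⇒ind-≡ : ∀ A B {x} → (x ∈ A → x ∈ B) → (x ∈ B → x ∈ A) → ind A x ≡ ind B x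
  ∈⇔⇒ind-≡ A B {x} to from with dec (A x)
  ... | yes x∈A = sym (ind-∈ B (to x∈A))
  ... | no x∉A  = sym (ind-∉ B (x∉A ∘ from))

  ind-mono : ∀ A B {x} → (x ∈ A → x ∈ B) → ind A x ℤ.≤ ind B x
  ind-mono A B {x} A⊆B with dec (A x) | dec (B x)
  ... | yes _   | yes _  = ℤ.≤-refl
  ... | yes x∈A | no x∉B = ⊥-elim (x∉B (A⊆B x∈A))
  ... | no _    | yes _  = ℤ.+≤+ ℕ.z≤n
  ... | no _    | no _   = ℤ.≤-refl

  ind-cong : ∀ {A B} → A ≐ B → ind A ≈ ind B
  ind-cong {A} {B} (A⊆B , B⊆A) = AE-always (λ x → ∈⇔⇒ind-≡ A B A⊆B B⊆A)

  ⊆⇒≲ : ∀ {A B} → A ⊆ B → ind A ≲ ind B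
  ⊆⇒≲ {A} {B} A⊆B = ≤⇒≲ (λ x → ind-mono A B A⊆B)

  null⇒≈𝟎 : ∀ {A} → AE (λ x → ¬ x ∈ A) → ind A ≈ 𝟎
  null⇒≈𝟎 {A} = AE-map (λ x → ind-∉ A)

  -- At most λ null sets of disagreement have a null union. Hence the value of a union depends only
  -- on the values of its pieces, which is what makes the transfinite sum well defined.
  ind-⋃-cong : {I : Set} (A B : I → Pred X 0ℓ) → I ≼ L → (∀ i → ind (A i) ≈ ind (B i)) →
    ind (⋃ I A) ≈ ind (⋃ I B)
  ind-⋃-cong {I} A B I≼L eqs = AE-map
    (λ x eq → ∈⇔⇒ind-≡ (⋃ I A) (⋃ I B)
      (λ (i , x∈Ai) → i , ind-≡⇒∈ (A i) (B i) (eq i) x∈Ai)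
      (λ (i , x∈Bi) → i , ind-≡⇒∈ (B i) (A i) (sym (eq i)) x∈Bi))
    (AE-⋂ I≼L eqs)

  𝟎≲ind : ∀ A → 𝟎 ≲ ind A
  𝟎≲ind A = ≤⇒≲ (λ x → subst (ℤ._≤ ind A x) (ind-∅ x) (ind-mono ∅ A {x} λ ()))

  cone-nonnull : ∀ t → ¬ AE (λ x → ¬ (x ∈ cone κ t))
  cone-nonnull t ae = cone-avoiding-nonnull t [] [] (AE-map (λ _ ∉t _ → ∉t) ae)

  -- The form in which dominance is applied: the hyperplane x i ≡ j, at a position not below the
  -- length of `t`, is the only exception.
  dominant-difference : ∀ A B t i j → ¬ (i < proj₁ t) →
    (∀ x → x i ≢ j → x ∈ A → x ∈ B) →
    (∀ x → x i ≢ j → x ∈ cone κ t → x ∈ B × ¬ x ∈ A) →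
    Dominant (ind B ⊖ ind A)
  dominant-difference A B t i j i≮t sub gap = t , (i , j) ∷ [] , i≮t ∷ [] , AE-always λ
    { x (xi≢j ∷ []) → ℤ.i≤j⇒0≤j-i (ind-mono A B (sub x xi≢j))
                    , λ x∈t → let x∈B , x∉A = gap x xi≢j x∈t in
                        ℤ.≤-reflexive (sym (cong₂ ℤ._-_ (ind-∈ B x∈B) (ind-∉ A x∉A))) }

  -- Points that differ from `s` at the position `proj₁ t` lie outside the cone of `s`, and this is
  -- an admissible condition for `t`. The two sequences may be incompatible.
  longer-cone-dominated : ∀ s t → proj₁ t < proj₁ s → Dominant (ind (cone κ t) ⊖ ind (cone κ s))
  longer-cone-dominated s t t<s = dominant-difference (cone κ s) (cone κ t) t (proj₁ t) (proj₂ s (proj₁ t , t<s))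
    (<-irrefl refl) (λ x x≢ x∈s → ⊥-elim (x≢ (x∈s _))) (λ x x≢ x∈t → x∈t , λ x∈s → x≢ (x∈s _))

  -- The monoid of values.

  InS : F → Set
  InS f = f ≈ 𝟎 ⊎ ∃[ t ] ind (cone κ t) ≲ f

  inS-resp : ∀ {f g} → f ≈ g → InS f → InS g
  inS-resp f≈g (inj₁ f≈0)       = inj₁ (≈-trans (≈-sym f≈g) f≈0)
  inS-resp f≈g (inj₂ (t , t≲f)) = inj₂ (t , ≲-trans t≲f (≲-reflexive f≈g))

  inS⇒𝟎≲ : ∀ {f} → InS f → 𝟎 ≲ f
  inS⇒𝟎≲ (inj₁ f≈0)       = ≲-reflexive (≈-sym f≈0)
  inS⇒𝟎≲ (inj₂ (t , t≲f)) = ≲-trans (𝟎≲ind (cone κ t)) t≲f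

  module G = AbelianGroup functionGroup

  inS-⊕ : ∀ {f g} → InS f → InS g → InS (f ⊕ g)
  inS-⊕ {f} {g} (inj₁ f≈0) g∈S = inS-resp (≈-sym (≈-trans (G.∙-congʳ f≈0) (G.identityˡ g))) g∈S
  inS-⊕ {f} {g} (inj₂ (t , t≲f)) g∈S =
    inj₂ (t , ≲-trans (≲-reflexive (≈-sym (G.identityʳ _))) (⊕-mono t≲f (inS⇒𝟎≲ g∈S)))

  inS-cone⊆ : ∀ A t → cone κ t ⊆ A → InS (ind A)
  inS-cone⊆ A t t⊆A = inj₂ (t , ⊆⇒≲ {cone κ t} {A} t⊆A)

  -- Either every piece is null, and so is the union, or some piece already lies above a cone.
  inS-⋃ : {I : Set} (A : I → Pred X 0ℓ) → I ≼ L → (∀ i → InS (ind (A i))) → InS (ind (⋃ I A))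
  inS-⋃ {I} A I≼L A∈S with dec (∀ i → ind (A i) ≈ 𝟎)
  ... | yes null = inj₁ (≈-trans
          (ind-⋃-cong A (λ _ → ∅) I≼L (λ i → ≈-trans (null i) (≈-sym (null⇒≈𝟎 (AE-always (λ _ ()))))))
          (null⇒≈𝟎 (AE-always (λ { _ (_ , ()) }))))
  ... | no ¬null with ¬∀⇒∃¬ ¬null
  ...   | i , ¬null-i with A∈S i
  ...     | inj₁ null-i     = ⊥-elim (¬null-i null-i)
  ...     | inj₂ (t , t≲Ai) = inj₂ (t , ≲-trans t≲Ai (⊆⇒≲ {A i} {⋃ I A} (i ,_)))

  -- The monoid of values: functions modulo ≈ that are 0 or above some cone, so
  -- that the cones at any point are coinitial in the positive values.
  record Value : Set where
    constructor value
    field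
      fn         : F
      .canonical : rep fn ≡ fn
      .inS       : InS fn

  open Value using (fn)

  -- The proof fields are irrelevant so that values are equal once their representatives are;
  -- excluded middle lets `recompute` recover them.
  fn-inS : ∀ v → InS (fn v)
  fn-inS (value _ _ inS) = recompute (dec _) inS

  fn-canonical : ∀ v → rep (fn v) ≡ fn v
  fn-canonical (value _ canonical _) = recompute (dec _) canonical

  valueOf : ∀ f → InS f → Value
  valueOf f f∈S = value (rep f) (rep-cong (rep-~ f)) (inS-resp (≈-sym (rep-~ f)) f∈S)

  fn-valueOf : ∀ f f∈S → fn (valueOf f f∈S) ≈ f
  fn-valueOf f _ = rep-~ f

  fn-≡ : ∀ {u v} → fn u ≡ fn v → u ≡ v
  fn-≡ {value f _ _} {value .f _ _} refl = refl

  fn-injective : ∀ {u v} → fn u ≈ fn v → u ≡ v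
  fn-injective {u} {v} u≈v = fn-≡ (trans (sym (fn-canonical u))
    (trans (rep-cong u≈v) (fn-canonical v)))

  infixl 6 _+ᵛ_
  _+ᵛ_ : Value → Value → Value
  u +ᵛ v = valueOf (fn u ⊕ fn v) (inS-⊕ (fn-inS u) (fn-inS v))

  fn-+ᵛ : ∀ u v → fn (u +ᵛ v) ≈ fn u ⊕ fn v
  fn-+ᵛ u v = rep-~ (fn u ⊕ fn v)

  0ᵛ : Value
  0ᵛ = valueOf 𝟎 (inj₁ ≈-refl)

  fn-0ᵛ : fn 0ᵛ ≈ 𝟎
  fn-0ᵛ = rep-~ 𝟎

  infix 4 _≤ᵛ_
  _≤ᵛ_ : Value → Value → Set
  u ≤ᵛ v = fn u ≲ fn v

  inS-U : InS (ind U)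
  inS-U = inS-cone⊆ U (0κ , λ _ → ι 0κ) _

  U-nonnull : ¬ ind U ≈ 𝟎
  U-nonnull U≈0 = cone-nonnull (0κ , λ _ → ι 0κ)
    (AE-map (λ x eq _ → ind-≡⇒∈ U ∅ {x} (trans eq (sym (ind-∅ x))) _) U≈0)

  1ᵛ : Value
  1ᵛ = valueOf (ind U) inS-U

  1ᵛ≢0ᵛ : 1ᵛ ≢ 0ᵛ
  1ᵛ≢0ᵛ eq = U-nonnull (≈-trans (≈-sym (rep-~ (ind U))) (≈-trans (subst (λ v → fn 1ᵛ ≈ fn v) eq ≈-refl) fn-0ᵛ))

  0ᵛ-minimum : ∀ v → 0ᵛ ≤ᵛ v
  0ᵛ-minimum v = ≲-resp-≈ (≈-sym fn-0ᵛ) ≈-refl (inS⇒𝟎≲ (fn-inS v))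

  values : PTOMonoid
  values = record
    { Carrier = Value ; 0# = 0ᵛ ; _+_ = _+ᵛ_ ; _≤_ = _≤ᵛ_
    ; isMonoid = record
      { isSemigroup = record
        { isMagma = record { isEquivalence = isEquivalence ; ∙-cong = cong₂ _+ᵛ_ }
        ; assoc   = λ u v w → fn-injective (≈-trans (fn-+ᵛ (u +ᵛ v) w) (≈-trans (G.∙-congʳ (fn-+ᵛ u v))
            (≈-trans (G.assoc (fn u) (fn v) (fn w))
            (≈-trans (G.∙-congˡ {fn u} (≈-sym (fn-+ᵛ v w))) (≈-sym (fn-+ᵛ u (v +ᵛ w)))))))
        }
      ; identity = (λ v → fn-injective (≈-trans (fn-+ᵛ 0ᵛ v) (≈-trans (G.∙-congʳ fn-0ᵛ) (G.identityˡ (fn v)))))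
                 , (λ v → fn-injective (≈-trans (fn-+ᵛ v 0ᵛ) (≈-trans (G.∙-congˡ {fn v} fn-0ᵛ) (G.identityʳ (fn v)))))
      }
    ; isTotalOrder = record
      { isPartialOrder = record
        { isPreorder = record
          { isEquivalence = isEquivalence
          ; reflexive     = λ { refl → ≲-reflexive ≈-refl }
          ; trans         = ≲-trans
          }
        ; antisym = λ p q → fn-injective (≲-antisym p q)
        }
      ; total = λ u v → ≲-total (fn u) (fn v)
      }
    ; +-mono-≤   = λ {u} {u′} {v} {v′} p q →
        ≲-resp-≈ (≈-sym (fn-+ᵛ u v)) (≈-sym (fn-+ᵛ u′ v′)) (⊕-mono p q)
    ; 0-minimum  = 0ᵛ-minimum
    ; nontrivial = 1ᵛ , 1ᵛ≢0ᵛ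
    }

  -- Transfinite sums.

  module _ {I : Set} where

    Disjoint : (I → Pred X 0ℓ) → Set
    Disjoint A = ∀ {i j} → i ≢ j → A i ⊥ A j

    -- The graph of the sum: `m` is realized by disjoint sets whose union has value `v`. Sequences
    -- that no disjoint family realizes stay outside the domain.
    Represents : (I → Value) → Value → Set₁
    Represents m v = I ≼ L × Σ[ A ∈ (I → Pred X 0ℓ) ]
      (Disjoint A × (∀ i → ind (A i) ≈ fn (m i)) × ind (⋃ I A) ≈ fn v)

    represents-unique : ∀ {m v w} → Represents m v → Represents m w → v ≡ w
    represents-unique (I≼L , A , _ , A≈ , ⋃A≈) (_ , B , _ , B≈ , ⋃B≈) = fn-injective
      (≈-trans (≈-sym ⋃A≈) (≈-trans (ind-⋃-cong A B I≼L (λ i → ≈-trans (A≈ i) (≈-sym (B≈ i)))) ⋃B≈))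

  represents-reindex : {I J : Set} (i : I ↔ J) {m : I → Value} {m′ : J → Value} {v : Value} →
    (∀ k → m′ (Inverse.to i k) ≡ m k) → Represents m v → Represents m′ v
  represents-reindex {I} {J} i {m} {m′} same (I≼L , A , disjoint , A≈ , ⋃A≈) =
    mk↣ {to = Injection.to I≼L ∘ from} (λ e → from-injective (Injection.injective I≼L e)) ,
    A ∘ from , (λ j≢k → disjoint (j≢k ∘ from-injective)) ,
    (λ j → subst (λ u → ind (A (from j)) ≈ fn u)
      (trans (sym (same (from j))) (cong m′ (strictlyInverseˡ j))) (A≈ (from j))) ,
    ≈-trans (ind-cong {⋃ J (A ∘ from)} {⋃ I A} ((λ { (j , x∈) → from j , x∈ })
      , λ { {x} (k , x∈) → to k , subst (λ k → x ∈ A k) (sym (strictlyInverseʳ k)) x∈ })) ⋃A≈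
    where
    open Inverse i using (to; from; strictlyInverseˡ; strictlyInverseʳ)

    from-injective : ∀ {j k} → from j ≡ from k → j ≡ k
    from-injective {j} {k} e = trans (sym (strictlyInverseˡ j)) (trans (cong to e) (strictlyInverseˡ k))

  Sum : OrdSeq Value → Maybe Value
  Sum s = describe (em {∃ (Represents (OrdSeq.at s))})

  represents⇒Sum : ∀ {s v} → Represents (OrdSeq.at s) v → Sum s ≡ just v
  represents⇒Sum {s} = describe-just (represents-unique {m = OrdSeq.at s}) em

  Sum⇒represents : ∀ {s v} → Sum s ≡ just v → Represents (OrdSeq.at s) v
  Sum⇒represents = describe-holds em

  Sum-cong : ∀ {s t} → s ≅ t → Sum s ≡ Sum t
  Sum-cong {s} {t} s≅t = describe-cong (represents-unique {m = OrdSeq.at s}) em em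
    (λ {v} → represents-reindex iso {OrdSeq.at s} {OrdSeq.at t} {v} same)
    (λ {v} → represents-reindex (↔-sym iso) {OrdSeq.at t} {OrdSeq.at s} {v} λ j →
      trans (sym (same (Inverse.from iso j))) (cong (OrdSeq.at t) (Inverse.strictlyInverseˡ iso j)))
    where open _≅_ s≅t

  sums : PartialSum values
  sums = record { Sum = Sum ; Sum-cong = Sum-cong }

  open PTOMonoid values using (rawMonoid)

  ind-⋃-sum : ∀ n (A : Fin n → Pred X 0ℓ) (m : Fin n → Value) → Disjoint A → (∀ i → ind (A i) ≈ fn (m i)) →
    ind (⋃ (Fin n) A) ≈ fn (sum rawMonoid m)
  ind-⋃-sum zero    A m _ _ = ≈-trans (null⇒≈𝟎 (AE-always (λ { _ (() , _) }))) (≈-sym fn-0ᵛ)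
  ind-⋃-sum (ℕ.suc n) A m disjoint A≈ = ≈-trans (AE-always split)
    (≈-trans (G.∙-cong (A≈ Fin.zero) tail) (≈-sym (fn-+ᵛ (m Fin.zero) (sum rawMonoid (m ∘ Fin.suc)))))
    where
    B : Pred X 0ℓ
    B = ⋃ (Fin n) (A ∘ Fin.suc)

    tail : ind B ≈ fn (sum rawMonoid (m ∘ Fin.suc))
    tail = ind-⋃-sum n (A ∘ Fin.suc) (m ∘ Fin.suc) (λ i≢j → disjoint (i≢j ∘ Fin.suc-injective)) (A≈ ∘ Fin.suc)

    split : ∀ x → ind (⋃ (Fin (ℕ.suc n)) A) x ≡ (ind (A Fin.zero) ⊕ ind B) x
    split x with dec (x ∈ A Fin.zero)
    ... | yes x∈A = trans (ind-∈ (⋃ (Fin (ℕ.suc n)) A) (Fin.zero , x∈A))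
          (sym (cong (λ z → 1ℤ ℤ.+ z) (ind-∉ B (λ (i , x∈Ai) → disjoint {Fin.zero} {Fin.suc i} (λ ()) (x∈A , x∈Ai)))))
    ... | no x∉A = trans (∈⇔⇒ind-≡ (⋃ (Fin (ℕ.suc n)) A) B
            (λ { (Fin.zero , x∈A) → ⊥-elim (x∉A x∈A) ; (Fin.suc i , x∈Ai) → i , x∈Ai })
            (λ (i , x∈Ai) → Fin.suc i , x∈Ai))
          (sym (ℤ.+-identityˡ (ind B x)))

  finite-sums : PartialSum.S1 sums
  finite-sums = (λ s → represents⇒Sum {⟨ finite 0 , s ⟩}
      ( mk↣ {to = λ ()} (λ { {()} }) , (λ ()) , (λ { {()} }) , (λ ())
      , ≈-trans (null⇒≈𝟎 (AE-always (λ { _ (() , _) }))) (≈-sym fn-0ᵛ)))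
    , λ n s v e → let _ , A , disjoint , A≈ , ⋃A≈ = Sum⇒represents {⟨ finite (ℕ.suc n) , s ⟩} e in
        fn-injective (≈-trans (≈-sym ⋃A≈) (ind-⋃-sum (ℕ.suc n) A s disjoint A≈))

  -- The measure and its properties.

  μ : Pred X 0ℓ → Maybe Value
  μ A = describe (dec (∃[ v ] ind A ≈ fn v))

  ind⇒μ : ∀ A {v} → ind A ≈ fn v → μ A ≡ just v
  ind⇒μ A = describe-just (λ A≈v A≈w → fn-injective (≈-trans (≈-sym A≈v) A≈w)) (dec _)

  μ⇒ind : ∀ A {v} → μ A ≡ just v → ind A ≈ fn v
  μ⇒ind A = describe-holds (dec _)

  -- This is exactly the domain of `μ`: `ind A` is equivalent to some value if and only if it
  -- satisfies `InS`. `Lift` only adjusts the universe.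
  Measurable : Pred (Pred X 0ℓ) (suc 0ℓ)
  Measurable A = Lift (suc 0ℓ) (InS (ind A))

  null-measurable : ∀ {A} → AE (λ x → ¬ x ∈ A) → Measurable A
  null-measurable null = lift (inj₁ (null⇒≈𝟎 null))

  point-null : ∀ x → AE (λ y → ¬ y ∈ ｛ x ｝)
  point-null x = almostEverywhere (λ _ → ι 0κ) λ ¬¬y≡x ¬¬z≡x _ → trans (sym (stable ¬¬y≡x)) (stable ¬¬z≡x)

  μ-valueOf : ∀ A (A∈S : InS (ind A)) → μ A ≡ just (valueOf (ind A) A∈S)
  μ-valueOf A A∈S = ind⇒μ A (≈-sym (fn-valueOf (ind A) A∈S))

  open Space (boundedSpace κ lam) using (Open)

  initial : X → K → Seq< κ L
  initial x a = a , x ∘ proj₁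

  open-contains-cone : ∀ {O x} → Open O → x ∈ O → ∃[ a ] cone κ (initial x a) ⊆ O
  open-contains-cone (generator (a , s)) x∈O = a , λ y∈ i → trans (y∈ i) (x∈O i)
  open-contains-cone (Generated.resp (P⊆Q , Q⊆P) o) x∈O =
    let a , ⊆P = open-contains-cone o (Q⊆P x∈O) in a , P⊆Q ∘ ⊆P
  open-contains-cone whole x∈O = 0κ , _
  open-contains-cone (inter o o′) (x∈P , x∈Q) =
    let a , ⊆P = open-contains-cone o x∈P
        b , ⊆Q = open-contains-cone o′ x∈Q
        c , a<c , b<c = above₂ a b
    in c , λ y∈ → ⊆P (λ (i , i<a) → y∈ (i , <-trans i<a a<c)) , ⊆Q (λ (i , i<b) → y∈ (i , <-trans i<b b<c))
  open-contains-cone (union o) (j , x∈) = let a , ⊆A = open-contains-cone (o j) x∈ in a , λ y∈ → j , ⊆A y∈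

  open-inS : ∀ {O} → Open O → InS (ind O)
  open-inS {O} o with dec (∃[ x ] x ∈ O)
  ... | yes (x , x∈O) = let a , ⊆O = open-contains-cone o x∈O in inS-cone⊆ O (initial x a) ⊆O
  ... | no empty      = inj₁ (null⇒≈𝟎 (AE-always (λ x x∈O → empty (x , x∈O))))

  disjoint-sum : {γ : Ordinal} → ∣ γ ∣ ≼ L → (A : ∣ γ ∣ → Pred X 0ℓ) → (∀ i → InS (ind (A i))) → Disjoint A →
    (m : ∣ γ ∣ → Value) → (∀ i → ind (A i) ≈ fn (m i)) →
    ∃[ v ] (Sum ⟨ γ , m ⟩ ≡ just v × ind (⋃ ∣ γ ∣ A) ≈ fn v)
  disjoint-sum {γ} γ≼L A A∈S disjoint m A≈ =
    valueOf (ind (⋃ ∣ γ ∣ A)) ⋃∈S , represents⇒Sum {⟨ γ , m ⟩} (γ≼L , A , disjoint , A≈ , ⋃≈) , ⋃≈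
    where
    ⋃∈S : InS (ind (⋃ ∣ γ ∣ A))
    ⋃∈S = inS-⋃ A γ≼L A∈S

    ⋃≈ : ind (⋃ ∣ γ ∣ A) ≈ fn (valueOf (ind (⋃ ∣ γ ∣ A)) ⋃∈S)
    ⋃≈ = ≈-sym (fn-valueOf _ ⋃∈S)

  measureSpace : WeakMeasureSpace lam (boundedSpace κ lam) values sums
  measureSpace = record
    { 𝔐      = Measurable
    ; 𝔐-resp = λ { {A} {B} A≐B (lift A∈S) → lift (inS-resp (ind-cong {A} {B} A≐B) A∈S) }
    ; 𝔐-⋃    = λ {I} {A} I≼L A∈S → lift (inS-⋃ A I≼L (lower ∘ A∈S))
    ; 𝔐-open = λ o → lift (open-inS o)
    ; μ      = μ
    ; μ-cong = λ {A} {B} A≐B → describe-cong (λ A≈v A≈w → fn-injective (≈-trans (≈-sym A≈v) A≈w)) (dec _) (dec _)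
        (≈-trans (ind-cong {B} {A} (proj₂ A≐B , proj₁ A≐B))) (≈-trans (ind-cong {A} {B} A≐B))
    ; μ-dom  = λ {A} A∈S → subst Is-just (sym (μ-valueOf A (lower A∈S))) (Maybe.just _)
    ; M1     = ind⇒μ ∅ (≈-trans (null⇒≈𝟎 (AE-always (λ _ ()))) (≈-sym fn-0ᵛ))
    ; M2     = 1ᵛ , μ-valueOf U inS-U , 0ᵛ-minimum 1ᵛ , 1ᵛ≢0ᵛ ∘ sym
    ; M3     = λ {A} {B} _ _ A⊆B μA μB → ≲-resp-≈ (μ⇒ind A μA) (μ⇒ind B μB) (⊆⇒≲ {A} {B} A⊆B)
    ; M4     = λ γ γ≼L A A∈S disjoint m μA →
        let v , Sum≡v , ⋃≈v = disjoint-sum {γ} γ≼L A (lower ∘ A∈S) disjoint m (λ i → μ⇒ind (A i) (μA i))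
        in v , Sum≡v , ind⇒μ (⋃ ∣ γ ∣ A) ⋃≈v
    ; M5     = λ x _ γ _ A basis v μx → isInf x γ A basis v μx
    }
    where
    isInf : ∀ x (γ : Ordinal) (A : ∣ γ ∣ → Pred X 0ℓ) → IsLocalBasis (boundedSpace κ lam) x A →
      ∀ v → μ ｛ x ｝ ≡ just v → PTOMonoid.IsInf values (λ w → ∃[ i ] μ (A i) ≡ just w) v
    isInf x γ A (opens , refines) v μx =
      (λ { {w} (i , _) → ≲-resp-≈ (≈-sym v≈0) ≈-refl (inS⇒𝟎≲ (fn-inS w)) }) ,
      λ u lower → ≲-reflexive (≈-trans (bound-null u lower (fn-inS u)) (≈-sym v≈0))
      where
      v≈0 : fn v ≈ 𝟎
      v≈0 = ≈-trans (≈-sym (μ⇒ind ｛ x ｝ μx)) (null⇒≈𝟎 (point-null x))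

      bound-null : ∀ u → (∀ {w} → (∃[ i ] μ (A i) ≡ just w) → u ≤ᵛ w) → InS (fn u) → fn u ≈ 𝟎
      bound-null u bound (inj₁ u≈0)       = u≈0
      -- A positive lower bound would exceed the cone of some `t`; but a basic set inside the cone
      -- of x restricted to a length beyond that of `t` has a strictly smaller value.
      bound-null u bound (inj₂ (t , t≲u)) with above (proj₁ t)
      ... | c , t<c with refines (cone κ (initial x c)) (generator (initial x c)) (λ _ → refl)
      ...   | i , Ai⊆N = ⊥-elim (dominant⇒≴ (longer-cone-dominated (initial x c) t t<c)
              (≲-trans t≲u (≲-trans (bound (i , μ-valueOf (A i) Ai∈S))
                (≲-trans (≲-reflexive (fn-valueOf (ind (A i)) Ai∈S)) (⊆⇒≲ {A i} {cone κ (initial x c)} Ai⊆N)))))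
        where
        Ai∈S : InS (ind (A i))
        Ai∈S = open-inS (proj₁ (opens i))

  continuous : WeakMeasureSpace.Continuous measureSpace
  continuous x = null-measurable (point-null x) ,
    ind⇒μ ｛ x ｝ (≈-trans (null⇒≈𝟎 (point-null x)) (≈-sym fn-0ᵛ))

  -- The support is the whole space. The constant sequences lie in the λ many disjoint cones `N j`,
  -- so base members chosen inside these have different indices.
  not-Dirac : ¬ WeakMeasureSpace.Dirac measureSpace lam
  not-Dirac (I , (_ , λ⋠I) , B , _ , base) = λ⋠I (mk↣ {to = proj₁ ∘ chosen} λ {j} {j′} eq →
    proj₂ (proj₂ (chosen j′)) (subst (λ i → const j ∈ B i) eq (proj₁ (proj₂ (chosen j))) , full-support (const j))
      (0κ , proj₂ (above 0κ)))
    where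
    full-support : ∀ x → x ∈ WeakMeasureSpace.supp measureSpace
    full-support x (O , o , μO≡0 , x∈O) =
      let a , ⊆O = open-contains-cone o x∈O
      in cone-nonnull (initial x a) (AE-map
        (λ y eq y∈ → ind-≡⇒∈ O ∅ (trans eq (sym (ind-∅ y))) (⊆O y∈))
        (≈-trans (μ⇒ind O μO≡0) fn-0ᵛ))

    N : L → Pred X 0ℓ
    N j = cone κ (initial (const j) 1κ)

    chosen : ∀ j → ∃[ i ] (const j ∈ B i × B i ∩ WeakMeasureSpace.supp measureSpace ⊆ N j)
    chosen j = base (N j) (const j) (generator _) (full-support (const j)) (λ _ → refl)

  -- Failure of continuity for the sums.

  -- The sets A i = {x | x 0κ = ι i} (i < κ) have positive values, and the
  -- value of ⋃ A minus a deep cone S still bounds all their partial sums.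
  not-continuous-sums : ¬ PartialSum.S2 sums
  not-continuous-sums s2 = v≰u (proj₂ (s2 ⟨ κ , m ⟩ v (0κ , above) Sum≡v
    λ a → let b , a<b = above a in b , a<b , subst Is-just (sym (proj₁ (proj₂ (partial b)))) (Maybe.just _)) u bound)
    where
    A : K → Pred X 0ℓ
    A i x = x 0κ ≡ ι i

    t : K → Seq< κ L
    t i = initial (const (ι i)) 1κ

    t⊆A : ∀ i → cone κ (t i) ⊆ A i
    t⊆A i x∈t = x∈t (0κ , proj₂ (above 0κ))

    -- Length `2κ` puts `S` inside the hyperplane x 1κ ≡ ι 0κ, and position `1κ` is not below the
    -- length `1κ` of the sequences `t i`; dominance over these can therefore ignore `S`.
    S : Pred X 0ℓ
    S = cone κ (initial (const (ι 0κ)) 2κ)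

    S⊆A : ∀ {x} → x ∈ S → x ∈ A 0κ
    S⊆A x∈S = x∈S (0κ , <-trans (proj₂ (above 0κ)) (proj₂ (above 1κ)))

    A∈S : ∀ i → InS (ind (A i))
    A∈S i = inS-cone⊆ (A i) (t i) (t⊆A i)

    disjoint : Disjoint A
    disjoint i≢j (x∈Ai , x∈Aj) = i≢j (ι-injective (trans (sym x∈Ai) x∈Aj))

    m : K → Value
    m i = valueOf (ind (A i)) (A∈S i)

    A≈ : ∀ i → ind (A i) ≈ fn (m i)
    A≈ i = ≈-sym (fn-valueOf _ (A∈S i))

    total : ∃[ v ] (Sum ⟨ κ , m ⟩ ≡ just v × ind (⋃ K A) ≈ fn v)
    total = disjoint-sum {κ} κ≼λ A A∈S disjoint m A≈

    v : Value
    v = proj₁ total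

    Sum≡v : Sum ⟨ κ , m ⟩ ≡ just v
    Sum≡v = proj₁ (proj₂ total)

    A< : ∀ a → Segment κ a → Pred X 0ℓ
    A< a i = A (proj₁ i)

    segment-ext : ∀ {a} {i j : Segment κ a} → proj₁ i ≡ proj₁ j → i ≡ j
    segment-ext {i = i , p} {.i , q} refl = cong (i ,_) (<-irrelevant p q)

    partial : ∀ a → ∃[ w ] (Sum (⟨ κ , m ⟩ ↾ a) ≡ just w × ind (⋃ (Segment κ a) (A< a)) ≈ fn w)
    partial a = disjoint-sum {segment κ a}
      (mk↣ {to = ι ∘ proj₁} (λ e → segment-ext (ι-injective e)))
      (A< a) (A∈S ∘ proj₁) (λ i≢j {x} → disjoint (i≢j ∘ segment-ext) {x}) (m ∘ proj₁) (A≈ ∘ proj₁)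

    D : Pred X 0ℓ
    D = ⋃ K A ∩ ∁ S

    D∈S : InS (ind D)
    -- Removing `S`, which lies in the piece `A 0κ`, leaves the piece `A 1κ` intact.
    D∈S = inS-cone⊆ D (t 1κ) λ x∈t → (1κ , t⊆A 1κ x∈t) ,
      λ x∈S → ι0≢ι1 (trans (sym (S⊆A x∈S)) (t⊆A 1κ x∈t))

    u : Value
    u = valueOf (ind D) D∈S

    bound : ∀ {w} → (∃[ a ] Sum (⟨ κ , m ⟩ ↾ a) ≡ just w) → w ≤ᵛ u
    bound {w} (a , Sum≡w) with partial a
    ... | w′ , Sum≡w′ , A<≈w′ with just-injective (trans (sym Sum≡w) Sum≡w′)
    ...   | refl = ≲-resp-≈ A<≈w′ (≈-sym (fn-valueOf _ D∈S)) (dominant⇒≲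
      -- Off the hyperplane containing `S`, the set `D` contains the partial union and also the cone
      -- of `t i₁`, which is disjoint from it because `i₁` is above `a`.
      (dominant-difference (⋃ (Segment κ a) (A< a)) D (t i₁) 1κ (ι 0κ) (<-irrefl refl)
        (λ { x x1≢ ((i , _) , x∈Ai) → (i , x∈Ai) , x∉S x1≢ })
        (λ x x1≢ x∈t → ((i₁ , t⊆A i₁ x∈t) , x∉S x1≢) ,
          λ { ((i , i<a) , x∈Ai) → <-irrefl (ι-injective (trans (sym x∈Ai) (t⊆A i₁ x∈t))) (<-trans i<a a<i₁) })))
      where
      i₁ : K
      i₁ = proj₁ (above a)

      a<i₁ : a < i₁
      a<i₁ = proj₂ (above a)

      x∉S : ∀ {x} → x 1κ ≢ ι 0κ → ¬ x ∈ S
      x∉S x1≢ x∈S = x1≢ (x∈S (1κ , proj₂ (above 1κ)))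

    v≰u : ¬ (v ≤ᵛ u)
    -- With antisymmetry, `D` and the whole union would agree almost everywhere, making `S` null.
    v≰u v≤u = cone-nonnull _ (AE-map
      (λ x eq x∈S → proj₂ (ind-≡⇒∈ (⋃ K A) D eq (0κ , S⊆A x∈S)) x∈S)
      (≲-antisym (≲-resp-≈ (≈-sym (proj₂ (proj₂ total))) (fn-valueOf _ D∈S) v≤u) (⊆⇒≲ {D} {⋃ K A} proj₁)))

theorem5p17 : ExcludedMiddle (suc 0ℓ) → Extensionality (suc 0ℓ) (suc 0ℓ) →
    (κ lam : Ordinal) → IsInfiniteCardinal κ → IsInfiniteCardinal lam →
    ∣ κ ∣ ≼ ∣ lam ∣ → IsRegular κ →
    Seq< κ ∣ lam ∣ ⤖ ∣ lam ∣ → ∣ lam ∣ ≺ Seqκ κ ∣ lam ∣ →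
    Σ[ S ∈ PTOMonoid ] Σ[ Σ∞ ∈ PartialSum S ]
    (PartialSum.S1 Σ∞ × ¬ PartialSum.S2 Σ∞ ×
    Σ[ M ∈ WeakMeasureSpace lam (boundedSpace κ lam) S Σ∞ ]
    (WeakMeasureSpace.Continuous M × ¬ WeakMeasureSpace.Dirac M lam))
theorem5p17 em ext κ lam κ-infinite _ κ≼λ regular coding λ≺X =
  values , sums , finite-sums , not-continuous-sums , measureSpace , continuous , not-Dirac
  where open Construction em ext κ lam κ-infinite κ≼λ regular coding λ≺X
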